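{- Let $n\ge 1$ be an integer. If $G$ is a connected graph of order $2n$ with a unique perfect matching, then $\rho(G)\leq\rho(G(2n,1))$, with equality if and only if $G\cong G(2n,1)$.
   Context: All graphs are finite, simple and undirected. The order of a graph is its number of vertices. For a graph $G$ with adjacency matrix $A(G)$, the spectral radius $\rho(G)$ is the largest eigenvalue of $A(G)$. The graph $G(2n,1)$ has order $2n$ and is defined as follows. Its vertex set is the disjoint union of $U=\{u_1,\ldots,u_n\}$ and $W=\{w_1,\ldots,w_n\}$; no two vertices of $U$ are adjacent, any two distinct vertices of $W$ are adjacent, and for each $1\leq i\leq n$ the set of neighbours of $u_i$ is exactly $\{w_1,w_2,\ldots,w_i\}$. -}

module Defs where

open import Algebra.Bundles using (RawMonoid)
open import Data.Bool.Base using (if_then_else_)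
open import Data.Empty using (⊥)
open import Data.Fin.Base as Fin using (Fin)
import Data.Fin.Properties as Fin
open import Data.Nat.Base as ℕ using (ℕ)
import Data.Nat.Properties as ℕ
open import Data.Product.Base using (Σ; _×_; _,_; proj₁; proj₂; ∃; ∃-syntax)
open import Data.Product using (∃!)
open import Data.Rational.Base as ℚ using (ℚ; 0ℚ; 1ℚ; ½; ∣_∣; Positive)
import Data.Rational.Properties as ℚ
open import Data.Rational.Solver using (module +-*-Solver)
open import Data.Sum.Base using (_⊎_; inj₁; inj₂)
open import Function.Base using (_∘_)
open import Function.Bundles using (_⇔_; _↔_; module Inverse)
open import Level using (0ℓ)
open import Relation.Binary.Core using (Rel; _⇒_)
open import Relation.Binary.Construct.Closure.ReflexiveTransitive using (Star)
open import Relation.Binary.Definitions using (Decidable; Irreflexive; Symmetric)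
open import Relation.Binary.PropositionalEquality
  using (_≡_; _≢_; refl; sym; trans; cong; subst)
open import Relation.Nullary using (¬_; does; no; ¬?)

Cauchy : (ℕ → ℚ) → Set
Cauchy x = ∀ ε → 0ℚ ℚ.< ε →
  ∃[ N ] ∀ m n → N ℕ.≤ m → N ℕ.≤ n → ∣ x m ℚ.- x n ∣ ℚ.≤ ε

-- Cauchy reals; the equality of real numbers is _≃_ below, not _≡_.
record ℝ : Set where
  constructor mkℝ
  field
    seq    : ℕ → ℚ
    cauchy : Cauchy seq

open ℝ public

infix 4 _≤_ _≃_

_≤_ : Rel ℝ 0ℓ
x ≤ y = ∀ ε → 0ℚ ℚ.< ε → ∃[ N ] ∀ n → N ℕ.≤ n → seq x n ℚ.≤ seq y n ℚ.+ ε

_≃_ : Rel ℝ 0ℓ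
x ≃ y = ∀ ε → 0ℚ ℚ.< ε → ∃[ N ] ∀ n → N ℕ.≤ n → ∣ seq x n ℚ.- seq y n ∣ ℚ.≤ ε

cauchy-const : ∀ q → Cauchy (λ _ → q)
cauchy-const q ε 0<ε = 0 , λ _ _ _ _ →
  subst (λ r → ∣ r ∣ ℚ.≤ ε) (sym (ℚ.+-inverseʳ q)) (ℚ.<⇒≤ 0<ε)

fromℚ : ℚ → ℝ
fromℚ q = mkℝ (λ _ → q) (cauchy-const q)

0ℝ 1ℝ : ℝ
0ℝ = fromℚ 0ℚ
1ℝ = fromℚ 1ℚ

private
  ½*-pos : ∀ {ε} → 0ℚ ℚ.< ε → 0ℚ ℚ.< ½ ℚ.* ε
  ½*-pos {ε} 0<ε = ℚ.positive⁻¹ (½ ℚ.* ε) {{ℚ.pos*pos⇒pos ½ ε {{ℚ.positive 0<ε}}}}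

  ½+½ : ∀ ε → ½ ℚ.* ε ℚ.+ ½ ℚ.* ε ≡ ε
  ½+½ ε = trans (sym (ℚ.*-distribʳ-+ ε ½ ½)) (ℚ.*-identityˡ ε)

  bounded : ∀ {x} → Cauchy x →
    ∃[ B ] Positive B × ∃[ N ] ∀ n → N ℕ.≤ n → ∣ x n ∣ ℚ.≤ B
  bounded {x} cx = 1ℚ ℚ.+ ∣ x N ∣ , B>0 , N , bound
    where
    N = proj₁ (cx 1ℚ (ℚ.positive⁻¹ 1ℚ))
    B>0 = ℚ.pos+nonNeg⇒pos 1ℚ ∣ x N ∣ {{ℚ.nonNegative (ℚ.0≤∣p∣ (x N))}}
    eq : ∀ a b → a ≡ (a ℚ.- b) ℚ.+ b
    eq = solve 2 (λ a b → a := (a :- b) :+ b) refl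
      where open +-*-Solver
    bound : ∀ n → N ℕ.≤ n → ∣ x n ∣ ℚ.≤ 1ℚ ℚ.+ ∣ x N ∣
    bound n N≤n = begin
      ∣ x n ∣                        ≡⟨ cong ∣_∣ (eq (x n) (x N)) ⟩
      ∣ (x n ℚ.- x N) ℚ.+ x N ∣      ≤⟨ ℚ.∣p+q∣≤∣p∣+∣q∣ (x n ℚ.- x N) (x N) ⟩
      ∣ x n ℚ.- x N ∣ ℚ.+ ∣ x N ∣    ≤⟨ ℚ.+-monoˡ-≤ ∣ x N ∣
                                         (proj₂ (cx 1ℚ (ℚ.positive⁻¹ 1ℚ)) n N N≤n ℕ.≤-refl) ⟩
      1ℚ ℚ.+ ∣ x N ∣                 ∎
      where open ℚ.≤-Reasoning

  scaled : ∀ B → Positive B → ∀ {ε} → 0ℚ ℚ.< ε → ∃[ δ ] 0ℚ ℚ.< δ × B ℚ.* δ ≡ ε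
  scaled B B>0 {ε} 0<ε = B⁻¹ ℚ.* ε , ℚ.positive⁻¹ (B⁻¹ ℚ.* ε) {{δ>0}} , B*δ
    where
    instance
      _ = B>0
      _ = ℚ.pos⇒nonZero B
      _ = ℚ.positive 0<ε
    B⁻¹ = ℚ.1/ B
    δ>0 : Positive (B⁻¹ ℚ.* ε)
    δ>0 = ℚ.pos*pos⇒pos B⁻¹ {{ℚ.1/pos⇒pos B}} ε
    B*δ : B ℚ.* (B⁻¹ ℚ.* ε) ≡ ε
    B*δ = trans (sym (ℚ.*-assoc B B⁻¹ ε))
            (trans (cong (ℚ._* ε) (ℚ.*-inverseʳ B)) (ℚ.*-identityˡ ε))

  *-mono : ∀ {p q r s} → 0ℚ ℚ.≤ r → 0ℚ ℚ.≤ q → p ℚ.≤ q → r ℚ.≤ s → p ℚ.* r ℚ.≤ q ℚ.* s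
  *-mono {p} {q} {r} {s} 0≤r 0≤q p≤q r≤s = ℚ.≤-trans
    (ℚ.*-monoʳ-≤-nonNeg r {{ℚ.nonNegative 0≤r}} p≤q)
    (ℚ.*-monoˡ-≤-nonNeg q {{ℚ.nonNegative 0≤q}} r≤s)

  *-close : ∀ {x y : ℕ → ℚ} {B C δ η ε} → Positive B → Positive C →
    B ℚ.* δ ≡ ½ ℚ.* ε → C ℚ.* η ≡ ½ ℚ.* ε → ∀ m n →
    ∣ x m ∣ ℚ.≤ B → ∣ y n ∣ ℚ.≤ C → ∣ y m ℚ.- y n ∣ ℚ.≤ δ → ∣ x m ℚ.- x n ∣ ℚ.≤ η →
    ∣ (x m ℚ.* y m) ℚ.- (x n ℚ.* y n) ∣ ℚ.≤ ε
  *-close {x} {y} {B} {C} {δ} {η} {ε} B>0 C>0 Bδ Cη m n x≤B y≤C y-close x-close = begin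
    ∣ (x m ℚ.* y m) ℚ.- (x n ℚ.* y n) ∣  ≡⟨ cong ∣_∣ (eq (x m) (y m) (x n) (y n)) ⟩
    ∣ x m ℚ.* (y m ℚ.- y n) ℚ.+ y n ℚ.* (x m ℚ.- x n) ∣
      ≤⟨ ℚ.∣p+q∣≤∣p∣+∣q∣ (x m ℚ.* (y m ℚ.- y n)) (y n ℚ.* (x m ℚ.- x n)) ⟩
    ∣ x m ℚ.* (y m ℚ.- y n) ∣ ℚ.+ ∣ y n ℚ.* (x m ℚ.- x n) ∣
      ≤⟨ ℚ.+-mono-≤ (term (x m) (y m ℚ.- y n) B>0 x≤B y-close Bδ)
                    (term (y n) (x m ℚ.- x n) C>0 y≤C x-close Cη) ⟩
    ½ ℚ.* ε ℚ.+ ½ ℚ.* ε                  ≡⟨ ½+½ ε ⟩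
    ε                                    ∎
    where
    open ℚ.≤-Reasoning
    eq : ∀ a b c d → (a ℚ.* b) ℚ.- (c ℚ.* d) ≡ a ℚ.* (b ℚ.- d) ℚ.+ d ℚ.* (a ℚ.- c)
    eq = solve 4 (λ a b c d → (a :* b) :- (c :* d) := a :* (b :- d) :+ d :* (a :- c)) refl
      where open +-*-Solver
    term : ∀ {D θ} p q → Positive D → ∣ p ∣ ℚ.≤ D → ∣ q ∣ ℚ.≤ θ → D ℚ.* θ ≡ ½ ℚ.* ε →
           ∣ p ℚ.* q ∣ ℚ.≤ ½ ℚ.* ε
    term {D} {θ} p q D>0 p≤ q≤ Dθ = begin
      ∣ p ℚ.* q ∣       ≡⟨ ℚ.∣p*q∣≡∣p∣*∣q∣ p q ⟩
      ∣ p ∣ ℚ.* ∣ q ∣   ≤⟨ *-mono (ℚ.0≤∣p∣ q) (ℚ.<⇒≤ (ℚ.positive⁻¹ D {{D>0}})) p≤ q≤ ⟩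
      D ℚ.* θ           ≡⟨ Dθ ⟩
      ½ ℚ.* ε           ∎

cauchy-+ : ∀ {x y : ℕ → ℚ} → Cauchy x → Cauchy y → Cauchy (λ n → x n ℚ.+ y n)
cauchy-+ {x} {y} cx cy ε 0<ε =
  let M , x-close = cx (½ ℚ.* ε) (½*-pos 0<ε)
      N , y-close = cy (½ ℚ.* ε) (½*-pos 0<ε)
  in M ℕ.⊔ N , λ m n m≥ n≥ → begin
    ∣ (x m ℚ.+ y m) ℚ.- (x n ℚ.+ y n) ∣  ≡⟨ cong ∣_∣ (eq (x m) (y m) (x n) (y n)) ⟩
    ∣ (x m ℚ.- x n) ℚ.+ (y m ℚ.- y n) ∣  ≤⟨ ℚ.∣p+q∣≤∣p∣+∣q∣ (x m ℚ.- x n) (y m ℚ.- y n) ⟩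
    ∣ x m ℚ.- x n ∣ ℚ.+ ∣ y m ℚ.- y n ∣  ≤⟨ ℚ.+-mono-≤
      (x-close m n (ℕ.m⊔n≤o⇒m≤o M N m≥) (ℕ.m⊔n≤o⇒m≤o M N n≥))
      (y-close m n (ℕ.m⊔n≤o⇒n≤o M N m≥) (ℕ.m⊔n≤o⇒n≤o M N n≥)) ⟩
    ½ ℚ.* ε ℚ.+ ½ ℚ.* ε                  ≡⟨ ½+½ ε ⟩
    ε                                    ∎
  where
  open ℚ.≤-Reasoning
  eq : ∀ a b c d → (a ℚ.+ b) ℚ.- (c ℚ.+ d) ≡ (a ℚ.- c) ℚ.+ (b ℚ.- d)
  eq = solve 4 (λ a b c d → (a :+ b) :- (c :+ d) := (a :- c) :+ (b :- d)) refl
    where open +-*-Solver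

cauchy-* : ∀ {x y : ℕ → ℚ} → Cauchy x → Cauchy y → Cauchy (λ n → x n ℚ.* y n)
cauchy-* {x} {y} cx cy ε 0<ε =
  let B , B>0 , N₁ , x≤B = bounded {x} cx
      C , C>0 , N₂ , y≤C = bounded {y} cy
      δ , 0<δ , Bδ = scaled B B>0 (½*-pos 0<ε)
      η , 0<η , Cη = scaled C C>0 (½*-pos 0<ε)
      N₃ , y-close = cy δ 0<δ
      N₄ , x-close = cx η 0<η
      L = N₁ ℕ.⊔ N₂
      R = N₃ ℕ.⊔ N₄
  in L ℕ.⊔ R , λ m n m≥ n≥ →
    let Lm = ℕ.m⊔n≤o⇒m≤o L R m≥ ; Rm = ℕ.m⊔n≤o⇒n≤o L R m≥
        Ln = ℕ.m⊔n≤o⇒m≤o L R n≥ ; Rn = ℕ.m⊔n≤o⇒n≤o L R n≥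
    in *-close {x} {y} B>0 C>0 Bδ Cη m n
         (x≤B m (ℕ.m⊔n≤o⇒m≤o N₁ N₂ Lm))
         (y≤C n (ℕ.m⊔n≤o⇒n≤o N₁ N₂ Ln))
         (y-close m n (ℕ.m⊔n≤o⇒m≤o N₃ N₄ Rm) (ℕ.m⊔n≤o⇒m≤o N₃ N₄ Rn))
         (x-close m n (ℕ.m⊔n≤o⇒n≤o N₃ N₄ Rm) (ℕ.m⊔n≤o⇒n≤o N₃ N₄ Rn))

infixl 6 _+_
infixl 7 _*_

_+_ : ℝ → ℝ → ℝ
x + y = mkℝ (λ n → seq x n ℚ.+ seq y n) (cauchy-+ {seq x} {seq y} (cauchy x) (cauchy y))

_*_ : ℝ → ℝ → ℝ
x * y = mkℝ (λ n → seq x n ℚ.* seq y n) (cauchy-* {seq x} {seq y} (cauchy x) (cauchy y))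

+-0-rawMonoid : RawMonoid 0ℓ 0ℓ
+-0-rawMonoid = record { Carrier = ℝ ; _≈_ = _≃_ ; _∙_ = _+_ ; ε = 0ℝ }

open import Algebra.Definitions.RawMonoid +-0-rawMonoid public using (sum)

record Graph : Set₁ where
  infix 4 _~_ _~?_
  field
    V        : Set
    order    : ℕ
    vertices : Fin order ↔ V
    _~_      : Rel V 0ℓ
    _~?_     : Decidable _~_
    ~-sym    : Symmetric _~_
    ~-irrefl : Irreflexive _≡_ _~_

  sumV : (V → ℝ) → ℝ
  sumV f = sum (f ∘ Inverse.to vertices)

  adjacency : V → V → ℝ
  adjacency u v = if does (u ~? v) then 1ℝ else 0ℝ

open Graph using (V; order)

infix 4 _≅_

record _≅_ (G H : Graph) : Set where
  private
    module G = Graph G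
    module H = Graph H
  field
    bijection : G.V ↔ H.V
    preserves : ∀ u v → (u G.~ v) ⇔ (Inverse.to bijection u H.~ Inverse.to bijection v)

Connected : Graph → Set
Connected G = ∀ u v → Star _~_ u v
  where open Graph G

-- A set of edges is represented as a symmetric subrelation of adjacency.
record PerfectMatching (G : Graph) : Set₁ where
  open Graph G using (_~_)
  field
    Matched : Rel (V G) 0ℓ
    symm    : Symmetric Matched
    edges   : Matched ⇒ _~_
    perfect : ∀ v → ∃! _≡_ (Matched v)

open PerfectMatching using (Matched)

HasUniquePerfectMatching : Graph → Set₁
HasUniquePerfectMatching G =
  Σ (PerfectMatching G) λ M → ∀ (M′ : PerfectMatching G) u v → Matched M u v ⇔ Matched M′ u v

IsEigenvalue : Graph → ℝ → Set
IsEigenvalue G r = Σ (G.V → ℝ) λ x →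
    ¬ (∀ v → x v ≃ 0ℝ)
  × (∀ v → G.sumV (λ w → G.adjacency v w * x w) ≃ r * x v)
  where module G = Graph G

-- The adjacency matrix is real symmetric, so all its eigenvalues are real.
-- ρ is given as a relation: IsSpectralRadius G r says that r is the largest
-- eigenvalue, which determines r up to _≃_.
IsSpectralRadius : Graph → ℝ → Set
IsSpectralRadius G r = IsEigenvalue G r × (∀ s → IsEigenvalue G s → s ≤ r)

-- inj₁ i is uᵢ and inj₂ i is wᵢ, with indices shifted to start from 0.
module _ (n : ℕ) where

  Adj : Rel (Fin n ⊎ Fin n) 0ℓ
  Adj (inj₁ i) (inj₁ j) = ⊥
  Adj (inj₁ i) (inj₂ j) = j Fin.≤ i
  Adj (inj₂ i) (inj₁ j) = i Fin.≤ j
  Adj (inj₂ i) (inj₂ j) = i ≢ j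

  Adj? : Decidable Adj
  Adj? (inj₁ i) (inj₁ j) = no λ ()
  Adj? (inj₁ i) (inj₂ j) = j Fin.≤? i
  Adj? (inj₂ i) (inj₁ j) = i Fin.≤? j
  Adj? (inj₂ i) (inj₂ j) = ¬? (i Fin.≟ j)

  Adj-sym : Symmetric Adj
  Adj-sym {inj₁ i} {inj₂ j} j≤i = j≤i
  Adj-sym {inj₂ i} {inj₁ j} i≤j = i≤j
  Adj-sym {inj₂ i} {inj₂ j} i≢j = i≢j ∘ sym

  Adj-irrefl : Irreflexive _≡_ Adj
  Adj-irrefl {inj₂ i} refl i≢i = i≢i refl

G[2_,1] : ℕ → Graph
G[2 n ,1] = record
  { V        = Fin n ⊎ Fin n
  ; order    = n ℕ.+ n
  ; vertices = Fin.+↔⊎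
  ; _~_      = Adj n
  ; _~?_     = Adj? n
  ; ~-sym    = λ {u} {v} → Adj-sym n {u} {v}
  ; ~-irrefl = λ {u} {v} → Adj-irrefl n {u} {v}
  }

{-# OPTIONS --safe #-}

-- Let x be an eigenvector of G for ρ(G), and y = |x|. Name the ends of every matching edge u and w
-- with y u ≤ y w, and number these edges by increasing ratio y u / y w. Since the perfect matching
-- is unique, G has no alternating 4-cycle, so for i < j at most one of the edges uᵢuⱼ, wᵢwⱼ and at
-- most one of uᵢwⱼ, wᵢuⱼ is present. The heavier edge of each pair, wᵢwⱼ and wᵢuⱼ, is the one present
-- in G(2n,1); hence ρ(G) yᵀy ≤ yᵀA(G)y ≤ yᵀA(G(2n,1))y ≤ ρ(G(2n,1)) yᵀy. The last inequality
-- follows from a positive eigenvector v of G(2n,1), whose eigenvalue is found by bisection as a root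
-- of a polynomial. If equality holds, then y is proportional to v, along which the two comparisons of
-- weights are strict, and this forces every edge.
-- Comparisons of reals, and with them the numbering of the matching edges, are available only under
-- a double negation. This suffices, since _≤_ is stable and isomorphism of finite graphs is decidable.

module Submission where

open import Defs using (ℝ; _≤_; _≃_; Graph; _≅_; Connected; HasUniquePerfectMatching; IsSpectralRadius; G[2_,1])
open import Data.Nat.Base using (ℕ; _≥_; _*_)
open import Data.Product.Base using (_×_)
open import Function.Bundles using (_⇔_)
open import Relation.Binary.PropositionalEquality using (_≡_)

import Defs
open import Defs using (mkℝ; seq; cauchy; fromℚ; IsEigenvalue; Adj; Adj?)
open import Algebra.Bundles using (CommutativeRing)
import Algebra.Solver.Ring
import Algebra.Solver.Ring.AlmostCommutativeRing as ACR
open import Data.Bool.Base using (Bool; true; false; if_then_else_)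
open import Data.Empty using (⊥)
open import Data.Fin.Base as Fin using (Fin; zero; suc)
open import Data.Fin.Permutation as Perm using (Permutation; _⟨$⟩ʳ_; _∘ₚ_; lift₀; transpose)
import Data.Fin.Properties as Fin
open import Data.Integer.Base as ℤ using (+_; -[1+_])
import Data.Integer.Properties as ℤ
open import Data.List.Base using (List; allFin; filter; length; lookup)
open import Data.List.Membership.Propositional using (_∈_)
open import Data.List.Membership.Propositional.Properties using (∈-lookup; ∈-allFin; ∈-filter⁺; ∈-filter⁻)
import Data.List.Relation.Unary.All as All
open import Data.List.Relation.Unary.AllPairs using (_∷_)
import Data.List.Relation.Unary.Any as Any
open import Data.List.Relation.Unary.Any.Properties using (lookup-index)
open import Data.List.Relation.Unary.Unique.Propositional using (Unique)
open import Data.List.Relation.Unary.Unique.Propositional.Properties as Unique using (allFin⁺)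
import Data.Maybe.Base as Maybe
open import Data.Nat.Base as ℕ using (zero; suc; z≤n; s≤s)
import Data.Nat.Coprimality as Coprimality
import Data.Nat.Properties as ℕ
open import Data.Product.Base using (Σ; _,_; proj₁; proj₂; ∃; ∃-syntax)
open import Data.Rational.Base as ℚ using (ℚ; mkℚ; 0ℚ; 1ℚ; ½; ∣_∣)
import Data.Rational.Properties as ℚ
open import Data.Rational.Solver using (module +-*-Solver)
import Data.Rational.Unnormalised.Base as ℚᵘ
import Data.Rational.Unnormalised.Properties as ℚᵘ
open import Data.Sum.Base as Sum using (_⊎_; inj₁; inj₂; [_,_]′)
open import Data.Sum.Function.Propositional using (_⊎-↔_)
open import Data.Unit.Base using (⊤; tt)
open import Data.Vec.Base as Vec using (Vec; []; _∷_)
open import Data.Vec.Properties using (lookup∘tabulate)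
open import Effect.Monad using (RawMonad)
open import Function.Base using (_∘_; id; _∋_; case_of_)
open import Function.Bundles using (_↔_; mk⤖; mk⇔; mk↔ₛ′; Inverse; Equivalence)
open import Function.Properties.Bijection using (⤖⇒↔)
open import Function.Properties.Inverse using (↔-sym; ↔-trans)
open import Level using (0ℓ)
open import Relation.Binary.Definitions using (tri<; tri≈; tri>; DecidableEquality; WeaklyDecidable)
open import Relation.Binary.PropositionalEquality using (_≢_; refl; sym; trans; cong; cong₂; subst; subst₂)
open import Relation.Nullary using (¬_; Dec; yes; no; does; ¬?; contradiction)
open import Relation.Nullary.Decidable
  using (map′; decidable-stable; dec⇒maybe; dec-true; dec-false; does-⇔; _→-dec_; _×-dec_)
open import Relation.Nullary.Negation using (¬¬-Monad)
open import Relation.Nullary.Negation.Core using (Stable; DoubleNegation)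

-- Real numbers

-- The hypothesis on `ρ*` makes it the largest eigenvalue of G(2n,1), but bounding yᵀA(G(2n,1))y by
-- a multiple of yᵀy takes a positive eigenvector. Hence a number `ρ` and a positive v are
-- constructed: positivity yields the bound from 2ab ≤ a² + b² alone, and `ρ ≼ ρ*` because `ρ*` is
-- largest. If ρ(G) equals `ρ*`, then `ρ ≼ ρG` closes the chain of inequalities. The numbering of
-- the matching edges gives only weak comparisons of weights. They suffice for the bound, but a tie
-- would allow the wrong edge of a pair. In v the ratio u / w strictly increases and u < w except in
-- the last pair, so ties are excluded once y is proportional to v. The recursion for v comes from
-- subtracting consecutive eigenvalue equations of G(2n,1): r (uᵢ₊₁ - uᵢ) = wᵢ₊₁ and (r + 1)(wᵢ -
-- wᵢ₊₁) = uᵢ. For the last pair the equations give u = w, whence the start 1, 1; a factor r (r + 1)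
-- at each step clears the denominators. The one equation left over, r u₁ = w₁, is the vanishing of
-- `D`.

≤-by-ℚ : ∀ {p q} r → 0ℚ ℚ.≤ r → p ℚ.+ r ≡ q → p ℚ.≤ q
≤-by-ℚ {p} {q} r 0≤r eq = subst₂ ℚ._≤_ (ℚ.+-identityʳ p) eq (ℚ.+-monoʳ-≤ p 0≤r)

p≤q⇒0≤q-p : ∀ {p q} → p ℚ.≤ q → 0ℚ ℚ.≤ q ℚ.- p
p≤q⇒0≤q-p {p} {q} p≤q = subst (ℚ._≤ q ℚ.- p) (ℚ.+-inverseʳ p) (ℚ.+-monoˡ-≤ (ℚ.- p) p≤q)

0≤+ : ∀ {p q} → 0ℚ ℚ.≤ p → 0ℚ ℚ.≤ q → 0ℚ ℚ.≤ p ℚ.+ q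
0≤+ 0≤p 0≤q = ℚ.+-mono-≤ 0≤p 0≤q

0≤* : ∀ {p q} → 0ℚ ℚ.≤ p → 0ℚ ℚ.≤ q → 0ℚ ℚ.≤ p ℚ.* q
0≤* {p} {q} 0≤p 0≤q = subst (ℚ._≤ p ℚ.* q) (ℚ.*-zeroˡ q)
  (ℚ.*-monoʳ-≤-nonNeg q {{ℚ.nonNegative 0≤q}} 0≤p)

0<* : ∀ {p q} → 0ℚ ℚ.< p → 0ℚ ℚ.< q → 0ℚ ℚ.< p ℚ.* q
0<* {p} {q} 0<p 0<q =
  ℚ.positive⁻¹ (p ℚ.* q) {{ℚ.pos*pos⇒pos p {{ℚ.positive 0<p}} q {{ℚ.positive 0<q}}}}

0<½ : 0ℚ ℚ.< ½
0<½ = ℚ.positive⁻¹ ½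

p≤∣p∣ : ∀ p → p ℚ.≤ ∣ p ∣
p≤∣p∣ p with ℚ.≤-total 0ℚ p
... | inj₁ 0≤p = ℚ.≤-reflexive (sym (ℚ.0≤p⇒∣p∣≡p 0≤p))
... | inj₂ p≤0 = ℚ.≤-trans p≤0 (ℚ.0≤∣p∣ p)

∣p-q∣≤r⇒p≤q+r : ∀ p q {r} → ∣ p ℚ.- q ∣ ℚ.≤ r → p ℚ.≤ q ℚ.+ r
∣p-q∣≤r⇒p≤q+r p q {r} h = ≤-by-ℚ (r ℚ.- (p ℚ.- q)) (p≤q⇒0≤q-p (ℚ.≤-trans (p≤∣p∣ (p ℚ.- q)) h))
  (solve 3 (λ p q r → p :+ (r :- (p :- q)) := q :+ r) refl p q r)
  where
  open +-*-Solver

∣p-q∣-sym : ∀ p q → ∣ p ℚ.- q ∣ ≡ ∣ q ℚ.- p ∣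
∣p-q∣-sym p q = trans (sym (ℚ.∣-p∣≡∣p∣ (p ℚ.- q)))
  (cong ∣_∣ (solve 2 (λ p q → :- (p :- q) := q :- p) refl p q))
  where open +-*-Solver

∣p-q∣≤r⇒q≤p+r : ∀ p q {r} → ∣ p ℚ.- q ∣ ℚ.≤ r → q ℚ.≤ p ℚ.+ r
∣p-q∣≤r⇒q≤p+r p q {r} h = ∣p-q∣≤r⇒p≤q+r q p (subst (ℚ._≤ r) (∣p-q∣-sym p q) h)

∣p-q∣≤r : ∀ {p q r} → p ℚ.≤ q ℚ.+ r → q ℚ.≤ p ℚ.+ r → ∣ p ℚ.- q ∣ ℚ.≤ r
∣p-q∣≤r {p} {q} {r} h k with ℚ.∣p∣≡p∨∣p∣≡-p (p ℚ.- q)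
... | inj₁ e = ≤-by-ℚ (q ℚ.+ r ℚ.- p) (p≤q⇒0≤q-p h)
  (trans (cong (ℚ._+ (q ℚ.+ r ℚ.- p)) e) (solve 3 (λ p q r → (p :- q) :+ ((q :+ r) :- p) := r) refl p q r))
  where open +-*-Solver
... | inj₂ e = ≤-by-ℚ (p ℚ.+ r ℚ.- q) (p≤q⇒0≤q-p k)
  (trans (cong (ℚ._+ (p ℚ.+ r ℚ.- q)) e) (solve 3 (λ p q r → :- (p :- q) :+ ((p :+ r) :- q) := r) refl p q r))
  where open +-*-Solver

Eventually : (ℕ → Set) → Set
Eventually P = ∃[ N ] ∀ n → N ℕ.≤ n → P n

eventually₂ : ∀ {P Q R : ℕ → Set} → (∀ n → P n → Q n → R n) →
  Eventually P → Eventually Q → Eventually R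
eventually₂ f (M , p) (N , q) = M ℕ.⊔ N , λ n h →
  f n (p n (ℕ.m⊔n≤o⇒m≤o M N h)) (q n (ℕ.m⊔n≤o⇒n≤o M N h))

eventually : ∀ {P Q : ℕ → Set} → (∀ n → P n → Q n) → Eventually P → Eventually Q
eventually f (M , p) = M , λ n h → f n (p n h)

infix 4 _≪_

-- The constructive strict order: its double negation is _≺_ below.
_≪_ : ℝ → ℝ → Set
x ≪ y = ∃[ δ ] 0ℚ ℚ.< δ × Eventually (λ n → seq x n ℚ.+ δ ℚ.≤ seq y n)

≪⇒≰ : ∀ x y → x ≪ y → ¬ (y ≤ x)
≪⇒≰ x y (δ , 0<δ , N , p) y≤x = ℚ.<-irrefl refl (ℚ.<-≤-trans ½δ<δ
    (absurd (M ℕ.⊔ N) (q _ (ℕ.m≤m⊔n M N)) (p _ (ℕ.m≤n⊔m M N))))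
  where
  open +-*-Solver
  ½δ = ½ ℚ.* δ
  ev = y≤x ½δ (0<* 0<½ 0<δ)
  M = proj₁ ev
  q = proj₂ ev
  ½δ<δ : ½δ ℚ.< δ
  ½δ<δ = subst₂ ℚ._<_ (ℚ.+-identityʳ ½δ) (trans (sym (ℚ.*-distribʳ-+ δ ½ ½)) (ℚ.*-identityˡ δ))
    (ℚ.+-monoʳ-< ½δ (0<* 0<½ 0<δ))
  absurd : ∀ n → seq y n ℚ.≤ seq x n ℚ.+ ½δ → seq x n ℚ.+ δ ℚ.≤ seq y n → δ ℚ.≤ ½δ
  absurd n h k = ≤-by-ℚ _ (p≤q⇒0≤q-p (ℚ.≤-trans k h))
    (solve 3 (λ d e a → d :+ ((a :+ e) :- (a :+ d)) := e) refl δ ½δ (seq x n))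

-- Both sequences stay within `θ` of their values at `N`, so one comparison of rationals, with half
-- of the tolerance as margin, decides. The alternatives overlap, which makes the choice
-- constructive.
≤⊎≪ : ∀ x y ε → 0ℚ ℚ.< ε → Eventually (λ n → seq x n ℚ.≤ seq y n ℚ.+ ε) ⊎ y ≪ x
≤⊎≪ x y ε 0<ε = compare (X ℚ.≤? Y ℚ.+ ½ ℚ.* ε)
  where
  open +-*-Solver
  -- Four times `θ` is the remaining ε/2 in either case: two are approximation errors, and in the
  -- second case a third is the gap.
  θ = ½ ℚ.* (½ ℚ.* (½ ℚ.* ε))
  0<θ : 0ℚ ℚ.< θ
  0<θ = 0<* 0<½ (0<* 0<½ (0<* 0<½ 0<ε))
  0≤θ = ℚ.<⇒≤ 0<θ
  Nx = proj₁ (cauchy x θ 0<θ)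
  Ny = proj₁ (cauchy y θ 0<θ)
  N = Nx ℕ.⊔ Ny
  X = seq x N
  Y = seq y N
  closex : ∀ n → N ℕ.≤ n → ∣ seq x n ℚ.- X ∣ ℚ.≤ θ
  closex n h = proj₂ (cauchy x θ 0<θ) n N (ℕ.m⊔n≤o⇒m≤o Nx Ny h) (ℕ.m≤m⊔n Nx Ny)
  closey : ∀ n → N ℕ.≤ n → ∣ seq y n ℚ.- Y ∣ ℚ.≤ θ
  closey n h = proj₂ (cauchy y θ 0<θ) n N (ℕ.m⊔n≤o⇒n≤o Nx Ny h) (ℕ.m≤n⊔m Nx Ny)
  compare : Dec (X ℚ.≤ Y ℚ.+ ½ ℚ.* ε) → _ ⊎ _
  compare (yes h) = inj₁ (N , λ n N≤n → ≤-by-ℚ _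
    (0≤+ (0≤+ (p≤q⇒0≤q-p (∣p-q∣≤r⇒p≤q+r (seq x n) X (closex n N≤n))) (p≤q⇒0≤q-p h))
         (0≤+ (p≤q⇒0≤q-p (∣p-q∣≤r⇒q≤p+r (seq y n) Y (closey n N≤n))) (0≤+ 0≤θ 0≤θ)))
    (solve 5 (λ xn yn X Y ε → let θ = con ½ :* (con ½ :* (con ½ :* ε)) in
      xn :+ ((((X :+ θ) :- xn) :+ ((Y :+ con ½ :* ε) :- X)) :+ (((yn :+ θ) :- Y) :+ (θ :+ θ)))
      := yn :+ ε) refl (seq x n) (seq y n) X Y ε))
  compare (no h) = inj₂ (θ , 0<θ , N , λ n N≤n → ≤-by-ℚ _
    (0≤+ (0≤+ (p≤q⇒0≤q-p (∣p-q∣≤r⇒q≤p+r (seq x n) X (closex n N≤n))) (p≤q⇒0≤q-p (ℚ.<⇒≤ (ℚ.≰⇒> h))))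
         (0≤+ (p≤q⇒0≤q-p (∣p-q∣≤r⇒p≤q+r (seq y n) Y (closey n N≤n))) 0≤θ))
    (solve 5 (λ xn yn X Y ε → let θ = con ½ :* (con ½ :* (con ½ :* ε)) in
      (yn :+ θ) :+ ((((xn :+ θ) :- X) :+ (X :- (Y :+ con ½ :* ε))) :+ (((Y :+ θ) :- yn) :+ θ))
      := xn) refl (seq x n) (seq y n) X Y ε))

-- The relations on real numbers are wrapped in records, and the operations are opaque,
-- so that Agda can infer real numbers from the types in which they occur.

infix 4 _≼_ _≈_ _≺_

record _≼_ (x y : ℝ) : Set where
  constructor ≤⇒≼
  field ≼⇒≤ : x ≤ y

record _≈_ (x y : ℝ) : Set where
  constructor ≃⇒≈
  field ≈⇒≃ : x ≃ y

open _≼_ public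
open _≈_ public

_≺_ : ℝ → ℝ → Set
x ≺ y = ¬ (y ≼ x)

private variable
  x y z x′ y′ : ℝ

≪⇒≺ : x ≪ y → x ≺ y
≪⇒≺ {x} {y} h (≤⇒≼ k) = ≪⇒≰ x y h k

-- The order is quantified over all tolerances, and at each of them `≤⊎≪` leaves one alternative
-- once `y ≪ x` is excluded. Stability of `_≼_` derives from this.
≮⇒≽ : ¬ (y ≪ x) → x ≼ y
≮⇒≽ {y} {x} h = ≤⇒≼ λ ε 0<ε → [ id , (λ y≪x → contradiction y≪x h) ]′ (≤⊎≪ x y ε 0<ε)

≺⇒¬¬≪ : x ≺ y → DoubleNegation (x ≪ y)
≺⇒¬¬≪ x<y h = x<y (≮⇒≽ h)

≼-stable : Stable (x ≼ y)
≼-stable h = ≮⇒≽ λ y≪x → h (≪⇒≺ y≪x)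

≺⇒≼ : x ≺ y → x ≼ y
≺⇒≼ {x} {y} x<y = ≼-stable λ h → ≺⇒¬¬≪ x<y λ (δ , 0<δ , ev) → h (≤⇒≼ λ ε 0<ε → eventually
  (λ n h → ℚ.≤-trans (≤-by-ℚ δ (ℚ.<⇒≤ 0<δ) refl) (ℚ.≤-trans h (≤-by-ℚ ε (ℚ.<⇒≤ 0<ε) refl))) ev)

pointwise-≼ : (∀ n → seq x n ℚ.≤ seq y n) → x ≼ y
pointwise-≼ h = ≤⇒≼ λ ε 0<ε → 0 , λ n _ → ℚ.≤-trans (h n) (≤-by-ℚ ε (ℚ.<⇒≤ 0<ε) refl)

≼-antisym : x ≼ y → y ≼ x → x ≈ y
≼-antisym (≤⇒≼ h) (≤⇒≼ k) = ≃⇒≈ λ ε 0<ε → eventually₂ (λ n → ∣p-q∣≤r) (h ε 0<ε) (k ε 0<ε)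

pointwise : (∀ n → seq x n ≡ seq y n) → x ≈ y
pointwise h = ≼-antisym (pointwise-≼ λ n → ℚ.≤-reflexive (h n))
                        (pointwise-≼ λ n → ℚ.≤-reflexive (sym (h n)))

≈⇒≼ : x ≈ y → x ≼ y
≈⇒≼ {x} {y} (≃⇒≈ h) = ≤⇒≼ λ ε 0<ε → eventually (λ n → ∣p-q∣≤r⇒p≤q+r (seq x n) (seq y n)) (h ε 0<ε)

≈⇒≽ : x ≈ y → y ≼ x
≈⇒≽ {x} {y} (≃⇒≈ h) = ≤⇒≼ λ ε 0<ε → eventually (λ n → ∣p-q∣≤r⇒q≤p+r (seq x n) (seq y n)) (h ε 0<ε)

≼-refl : x ≼ x
≼-refl = pointwise-≼ λ n → ℚ.≤-refl

split-ε : ∀ ε → 0ℚ ℚ.< ε → ∃[ δ ] 0ℚ ℚ.< δ × δ ℚ.+ δ ≡ ε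
split-ε ε 0<ε = ½ ℚ.* ε , 0<* 0<½ 0<ε , trans (sym (ℚ.*-distribʳ-+ ε ½ ½)) (ℚ.*-identityˡ ε)

≼-trans : x ≼ y → y ≼ z → x ≼ z
≼-trans {x} {y} {z} (≤⇒≼ h) (≤⇒≼ k) = ≤⇒≼ λ ε 0<ε → half (split-ε ε 0<ε)
  where
  open +-*-Solver
  half : ∀ {ε} → ∃[ δ ] 0ℚ ℚ.< δ × δ ℚ.+ δ ≡ ε → Eventually (λ n → seq x n ℚ.≤ seq z n ℚ.+ ε)
  half (δ , 0<δ , refl) = eventually₂ (λ n a b → ≤-by-ℚ _ (0≤+ (p≤q⇒0≤q-p a) (p≤q⇒0≤q-p b))
    (solve 4 (λ x y z d → x :+ (((y :+ d) :- x) :+ ((z :+ d) :- y)) := z :+ (d :+ d)) refl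
      (seq x n) (seq y n) (seq z n) δ)) (h δ 0<δ) (k δ 0<δ)

≈-refl : x ≈ x
≈-refl = ≼-antisym ≼-refl ≼-refl

≈-sym : x ≈ y → y ≈ x
≈-sym h = ≼-antisym (≈⇒≽ h) (≈⇒≼ h)

≈-trans : x ≈ y → y ≈ z → x ≈ z
≈-trans h k = ≼-antisym (≼-trans (≈⇒≼ h) (≈⇒≼ k)) (≼-trans (≈⇒≽ k) (≈⇒≽ h))

eventually-bounded : ∀ x → ∃[ B ] 0ℚ ℚ.< B × Eventually (λ n → ∣ seq x n ∣ ℚ.≤ B)
eventually-bounded x = 1ℚ ℚ.+ ∣ seq x N ∣
  , ℚ.<-≤-trans (ℚ.positive⁻¹ 1ℚ) (≤-by-ℚ _ (ℚ.0≤∣p∣ (seq x N)) refl)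
  , N , λ n h → begin
    ∣ seq x n ∣                             ≡⟨ cong ∣_∣ (eq (seq x n) (seq x N)) ⟩
    ∣ (seq x n ℚ.- seq x N) ℚ.+ seq x N ∣   ≤⟨ ℚ.∣p+q∣≤∣p∣+∣q∣ (seq x n ℚ.- seq x N) (seq x N) ⟩
    ∣ seq x n ℚ.- seq x N ∣ ℚ.+ ∣ seq x N ∣ ≤⟨ ℚ.+-monoˡ-≤ ∣ seq x N ∣ (close n N h ℕ.≤-refl) ⟩
    1ℚ ℚ.+ ∣ seq x N ∣ ∎
  where
  open ℚ.≤-Reasoning
  open +-*-Solver
  N = proj₁ (cauchy x 1ℚ (ℚ.positive⁻¹ 1ℚ))
  close = proj₂ (cauchy x 1ℚ (ℚ.positive⁻¹ 1ℚ))
  eq : ∀ a b → a ≡ (a ℚ.- b) ℚ.+ b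
  eq = solve 2 (λ a b → a := (a :- b) :+ b) refl

neg : ℝ → ℝ
neg x = mkℝ (λ n → ℚ.- seq x n) λ ε 0<ε → proj₁ (cauchy x ε 0<ε) , λ m n hm hn →
  subst (ℚ._≤ ε) (trans (∣p-q∣-sym (seq x m) (seq x n)) (cong ∣_∣ (eq (seq x m) (seq x n))))
    (proj₂ (cauchy x ε 0<ε) m n hm hn)
  where
  open +-*-Solver
  eq : ∀ a b → b ℚ.- a ≡ (ℚ.- a) ℚ.- (ℚ.- b)
  eq = solve 2 (λ a b → b :- a := (:- a) :- (:- b)) refl

abs : ℝ → ℝ
abs x = mkℝ (λ n → ∣ seq x n ∣) λ ε 0<ε → proj₁ (cauchy x ε 0<ε) , λ m n hm hn →
  ∣p-q∣≤r (lip (seq x m) (seq x n) (proj₂ (cauchy x ε 0<ε) m n hm hn))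
          (lip (seq x n) (seq x m) (proj₂ (cauchy x ε 0<ε) n m hn hm))
  where
  open +-*-Solver
  lip : ∀ p q {ε} → ∣ p ℚ.- q ∣ ℚ.≤ ε → ∣ p ∣ ℚ.≤ ∣ q ∣ ℚ.+ ε
  lip p q {ε} h = ℚ.≤-trans
    (subst (λ r → ∣ r ∣ ℚ.≤ ∣ q ∣ ℚ.+ ∣ p ℚ.- q ∣) (solve 2 (λ p q → q :+ (p :- q) := p) refl p q)
      (ℚ.∣p+q∣≤∣p∣+∣q∣ q (p ℚ.- q)))
    (ℚ.+-monoʳ-≤ ∣ q ∣ h)

+-mono-≤ : ∀ x x′ y y′ → x ≤ x′ → y ≤ y′ → (x Defs.+ y) ≤ (x′ Defs.+ y′)
+-mono-≤ x x′ y y′ h k ε 0<ε = half (split-ε ε 0<ε)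
  where
  open +-*-Solver
  half : ∀ {ε} → ∃[ δ ] 0ℚ ℚ.< δ × δ ℚ.+ δ ≡ ε →
    Eventually (λ n → seq x n ℚ.+ seq y n ℚ.≤ (seq x′ n ℚ.+ seq y′ n) ℚ.+ ε)
  half (δ , 0<δ , refl) = eventually₂ (λ n a b → ≤-by-ℚ _ (0≤+ (p≤q⇒0≤q-p a) (p≤q⇒0≤q-p b))
    (solve 5 (λ x y x′ y′ d →
      (x :+ y) :+ (((x′ :+ d) :- x) :+ ((y′ :+ d) :- y)) := (x′ :+ y′) :+ (d :+ d)) refl
      (seq x n) (seq y n) (seq x′ n) (seq y′ n) δ)) (h δ 0<δ) (k δ 0<δ)

neg-antimono-≤ : ∀ x y → x ≤ y → neg y ≤ neg x
neg-antimono-≤ x y h ε 0<ε = eventually (λ n a → ≤-by-ℚ _ (p≤q⇒0≤q-p a)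
    (solve 3 (λ x y ε → :- y :+ ((y :+ ε) :- x) := :- x :+ ε) refl (seq x n) (seq y n) ε)) (h ε 0<ε)
  where open +-*-Solver

*-congʳ : ∀ x y z → x ≃ y → (x Defs.* z) ≃ (y Defs.* z)
*-congʳ x y z h ε 0<ε = limit (eventually-bounded z)
  where
  limit : ∃[ B ] 0ℚ ℚ.< B × Eventually (λ n → ∣ seq z n ∣ ℚ.≤ B) →
    Eventually (λ n → ∣ seq x n ℚ.* seq z n ℚ.- seq y n ℚ.* seq z n ∣ ℚ.≤ ε)
  limit (B , 0<B , ev) = eventually₂ bound (h (1/B ℚ.* ε) (0<* 0<1/B 0<ε)) ev
    where
    open ℚ.≤-Reasoning
    open +-*-Solver
    instance
      _ = ℚ.positive 0<B
      _ = ℚ.pos⇒nonZero B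
    1/B = ℚ.1/ B
    0<1/B : 0ℚ ℚ.< 1/B
    0<1/B = ℚ.positive⁻¹ 1/B {{ℚ.1/pos⇒pos B}}
    bound : ∀ n → ∣ seq x n ℚ.- seq y n ∣ ℚ.≤ 1/B ℚ.* ε → ∣ seq z n ∣ ℚ.≤ B →
            ∣ seq x n ℚ.* seq z n ℚ.- seq y n ℚ.* seq z n ∣ ℚ.≤ ε
    bound n p q = begin
      ∣ a ℚ.* c ℚ.- b ℚ.* c ∣  ≡⟨ cong ∣_∣ (solve 3 (λ a b c → a :* c :- b :* c := (a :- b) :* c) refl a b c) ⟩
      ∣ (a ℚ.- b) ℚ.* c ∣      ≡⟨ ℚ.∣p*q∣≡∣p∣*∣q∣ (a ℚ.- b) c ⟩
      ∣ a ℚ.- b ∣ ℚ.* ∣ c ∣    ≤⟨ ℚ.*-monoʳ-≤-nonNeg ∣ c ∣ {{ℚ.∣-∣-nonNeg c}} p ⟩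
      1/B ℚ.* ε ℚ.* ∣ c ∣      ≤⟨ ℚ.*-monoˡ-≤-nonNeg (1/B ℚ.* ε) {{ℚ.nonNegative (ℚ.<⇒≤ (0<* 0<1/B 0<ε))}} q ⟩
      1/B ℚ.* ε ℚ.* B          ≡⟨ solve 3 (λ i e b → i :* e :* b := (i :* b) :* e) refl 1/B ε B ⟩
      (1/B ℚ.* B) ℚ.* ε        ≡⟨ cong (ℚ._* ε) (ℚ.*-inverseˡ B) ⟩
      1ℚ ℚ.* ε                 ≡⟨ ℚ.*-identityˡ ε ⟩
      ε ∎
      where
      a = seq x n
      b = seq y n
      c = seq z n

0≪x*y : ∀ x y → fromℚ 0ℚ ≪ x → fromℚ 0ℚ ≪ y → fromℚ 0ℚ ≪ x Defs.* y
0≪x*y x y (δ , 0<δ , p) (η , 0<η , q) = δ ℚ.* η , 0<* 0<δ 0<η , eventually₂ product p q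
  where
  product : ∀ n → 0ℚ ℚ.+ δ ℚ.≤ seq x n → 0ℚ ℚ.+ η ℚ.≤ seq y n →
    0ℚ ℚ.+ δ ℚ.* η ℚ.≤ seq x n ℚ.* seq y n
  product n a b = subst (ℚ._≤ seq x n ℚ.* seq y n) (sym (ℚ.+-identityˡ (δ ℚ.* η)))
    (ℚ.≤-trans (ℚ.*-monoʳ-≤-nonNeg η {{ℚ.nonNegative (ℚ.<⇒≤ 0<η)}} δ≤x)
      (ℚ.*-monoˡ-≤-nonNeg (seq x n) {{ℚ.nonNegative (ℚ.≤-trans (ℚ.<⇒≤ 0<δ) δ≤x)}} η≤y))
    where
    δ≤x : δ ℚ.≤ seq x n
    δ≤x = subst (ℚ._≤ seq x n) (ℚ.+-identityˡ δ) a
    η≤y : η ℚ.≤ seq y n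
    η≤y = subst (ℚ._≤ seq y n) (ℚ.+-identityˡ η) b

∣p∣*∣p∣≡p*p : ∀ p → ∣ p ∣ ℚ.* ∣ p ∣ ≡ p ℚ.* p
∣p∣*∣p∣≡p*p p with ℚ.∣p∣≡p∨∣p∣≡-p p
... | inj₁ e = cong₂ ℚ._*_ e e
... | inj₂ e = trans (cong₂ ℚ._*_ e e) (solve 1 (λ p → (:- p) :* (:- p) := p :* p) refl p)
  where open +-*-Solver

-- The ordered commutative ring of real numbers

infix 8 -_
infixl 7 _·_
infixl 6 _+_

opaque

  ⌜_⌝ : ℚ → ℝ
  ⌜_⌝ = fromℚ

  _+_ _·_ : ℝ → ℝ → ℝ
  _+_ = Defs._+_
  _·_ = Defs._*_

  -_ ∣_∣ℝ : ℝ → ℝ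
  -_ = neg
  ∣_∣ℝ = abs

0# 1# : ℝ
0# = ⌜ 0ℚ ⌝
1# = ⌜ 1ℚ ⌝

opaque
  unfolding ⌜_⌝

  +-mono-≼ : x ≼ x′ → y ≼ y′ → x + y ≼ x′ + y′
  +-mono-≼ {x} {x′} {y} {y′} (≤⇒≼ h) (≤⇒≼ k) = ≤⇒≼ (+-mono-≤ x x′ y y′ h k)

  neg-antimono-≼ : x ≼ y → - y ≼ - x
  neg-antimono-≼ {x} {y} (≤⇒≼ h) = ≤⇒≼ (neg-antimono-≤ x y h)

  ·-congʳ : ∀ z → x ≈ y → x · z ≈ y · z
  ·-congʳ {x} {y} z (≃⇒≈ h) = ≃⇒≈ (*-congʳ x y z h)

  0≺x·y : 0# ≺ x → 0# ≺ y → 0# ≺ x · y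
  0≺x·y {x} {y} 0<x 0<y xy≤0 = ≺⇒¬¬≪ 0<x λ 0≪x → ≺⇒¬¬≪ 0<y λ 0≪y →
    ≪⇒≺ {fromℚ 0ℚ} {x Defs.* y} (0≪x*y x y 0≪x 0≪y) xy≤0

  0≼∣x∣ : ∀ x → 0# ≼ ∣ x ∣ℝ
  0≼∣x∣ x = pointwise-≼ λ n → ℚ.0≤∣p∣ (seq x n)

  ∣x∣·∣x∣≈x·x : ∀ x → ∣ x ∣ℝ · ∣ x ∣ℝ ≈ x · x
  ∣x∣·∣x∣≈x·x x = pointwise λ n → ∣p∣*∣p∣≡p*p (seq x n)

  x·y≼∣x∣·∣y∣ : ∀ x y → x · y ≼ ∣ x ∣ℝ · ∣ y ∣ℝ
  x·y≼∣x∣·∣y∣ x y = pointwise-≼ λ n → subst (seq x n ℚ.* seq y n ℚ.≤_)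
    (ℚ.∣p*q∣≡∣p∣*∣q∣ (seq x n) (seq y n)) (p≤∣p∣ (seq x n ℚ.* seq y n))

  ⌜⌝-+ : ∀ p q → ⌜ p ℚ.+ q ⌝ ≈ ⌜ p ⌝ + ⌜ q ⌝
  ⌜⌝-+ p q = pointwise λ n → refl

  ⌜⌝-· : ∀ p q → ⌜ p ℚ.* q ⌝ ≈ ⌜ p ⌝ · ⌜ q ⌝
  ⌜⌝-· p q = pointwise λ n → refl

  ⌜⌝-neg : ∀ p → ⌜ ℚ.- p ⌝ ≈ - ⌜ p ⌝
  ⌜⌝-neg p = pointwise λ n → refl

  ⌜⌝-mono-< : ∀ {p q} → p ℚ.< q → ⌜ p ⌝ ≺ ⌜ q ⌝
  ⌜⌝-mono-< {p} {q} p<q h = ≪⇒≰ (fromℚ p) (fromℚ q)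
    (q ℚ.- p , subst (ℚ._< q ℚ.- p) (ℚ.+-inverseʳ p) (ℚ.+-monoˡ-< (ℚ.- p) p<q)
    , 0 , λ n _ → ℚ.≤-reflexive (solve 2 (λ p q → p :+ (q :- p) := q) refl p q)) (≼⇒≤ h)
    where open +-*-Solver

  +-assoc : ∀ x y z → (x + y) + z ≈ x + (y + z)
  +-assoc x y z = pointwise λ n → ℚ.+-assoc (seq x n) (seq y n) (seq z n)

  +-comm : ∀ x y → x + y ≈ y + x
  +-comm x y = pointwise λ n → ℚ.+-comm (seq x n) (seq y n)

  +-identityˡ : ∀ x → 0# + x ≈ x
  +-identityˡ x = pointwise λ n → ℚ.+-identityˡ (seq x n)

  +-inverseˡ : ∀ x → (- x) + x ≈ 0#
  +-inverseˡ x = pointwise λ n → ℚ.+-inverseˡ (seq x n)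

  ·-assoc : ∀ x y z → (x · y) · z ≈ x · (y · z)
  ·-assoc x y z = pointwise λ n → ℚ.*-assoc (seq x n) (seq y n) (seq z n)

  ·-comm : ∀ x y → x · y ≈ y · x
  ·-comm x y = pointwise λ n → ℚ.*-comm (seq x n) (seq y n)

  ·-identityˡ : ∀ x → 1# · x ≈ x
  ·-identityˡ x = pointwise λ n → ℚ.*-identityˡ (seq x n)

  ·-distribˡ-+ : ∀ x y z → x · (y + z) ≈ x · y + x · z
  ·-distribˡ-+ x y z = pointwise λ n → ℚ.*-distribˡ-+ (seq x n) (seq y n) (seq z n)

+-cong : x ≈ x′ → y ≈ y′ → x + y ≈ x′ + y′
+-cong h k = ≼-antisym (+-mono-≼ (≈⇒≼ h) (≈⇒≼ k)) (+-mono-≼ (≈⇒≽ h) (≈⇒≽ k))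

·-cong : x ≈ x′ → y ≈ y′ → x · y ≈ x′ · y′
·-cong {x} {x′} {y} {y′} h k = ≈-trans (·-congʳ y h)
  (≈-trans (·-comm x′ y) (≈-trans (·-congʳ x′ k) (·-comm y′ x′)))

ℝ-commutativeRing : CommutativeRing 0ℓ 0ℓ
ℝ-commutativeRing = record
  { Carrier = ℝ ; _≈_ = _≈_ ; _+_ = _+_ ; _*_ = _·_ ; -_ = -_ ; 0# = 0# ; 1# = 1#
  ; isCommutativeRing = record
    { isRing = record
      { +-isAbelianGroup = record
        { isGroup = record
          { isMonoid = record
            { isSemigroup = record
              { isMagma = record
                { isEquivalence = record { refl = ≈-refl ; sym = ≈-sym ; trans = ≈-trans }
                ; ∙-cong = +-cong }
              ; assoc = +-assoc }
            ; identity = +-identityˡ , λ x → ≈-trans (+-comm x 0#) (+-identityˡ x) }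
          ; inverse = +-inverseˡ , λ x → ≈-trans (+-comm x (- x)) (+-inverseˡ x)
          ; ⁻¹-cong = λ h → ≼-antisym (neg-antimono-≼ (≈⇒≽ h)) (neg-antimono-≼ (≈⇒≼ h)) }
        ; comm = +-comm }
      ; *-cong = ·-cong
      ; *-assoc = ·-assoc
      ; *-identity = ·-identityˡ , λ x → ≈-trans (·-comm x 1#) (·-identityˡ x)
      ; distrib = ·-distribˡ-+ , λ x y z → ≈-trans (·-comm (y + z) x)
          (≈-trans (·-distribˡ-+ x y z) (+-cong (·-comm x y) (·-comm x z))) }
    ; *-comm = ·-comm } }

-- Lets the ring solver compute with rational coefficients and compare them decidably in ℚ, which is
-- impossible for real ones.
⌜⌝-homomorphism : CommutativeRing.rawRing ℚ.+-*-commutativeRing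
  ACR.-Raw-AlmostCommutative⟶ ACR.fromCommutativeRing ℝ-commutativeRing
⌜⌝-homomorphism = record
  { ⟦_⟧ = ⌜_⌝ ; +-homo = ⌜⌝-+ ; *-homo = ⌜⌝-· ; -‿homo = ⌜⌝-neg ; 0-homo = ≈-refl ; 1-homo = ≈-refl }

⌜⌝-weaklyDecidable : WeaklyDecidable (ACR.Induced-equivalence ⌜⌝-homomorphism)
⌜⌝-weaklyDecidable p q = Maybe.map (λ { refl → ≈-refl }) (dec⇒maybe (p ℚ.≟ q))

module ≈-Solver = Algebra.Solver.Ring (CommutativeRing.rawRing ℚ.+-*-commutativeRing)
  (ACR.fromCommutativeRing ℝ-commutativeRing) ⌜⌝-homomorphism ⌜⌝-weaklyDecidable

import Algebra.Properties.Semiring.Sum (CommutativeRing.semiring ℝ-commutativeRing) as ∑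

infixl 6 _-_

_-_ : ℝ → ℝ → ℝ
x - y = x + (- y)

-‿cong : x ≈ y → - x ≈ - y
-‿cong = CommutativeRing.-‿cong ℝ-commutativeRing

≡⇒≈ : x ≡ y → x ≈ y
≡⇒≈ refl = ≈-refl

-- As with `≤-by-ℚ`, an inequality is certified by a nonnegative difference together with a ring
-- identity, which is left to the solver.
≼-by : ∀ z → 0# ≼ z → x + z ≈ y → x ≼ y
≼-by {x} z 0≤z eq = ≼-trans (≈⇒≼ (solve 1 (λ x → x := x :+ con 0ℚ) ≈-refl x))
  (≼-trans (+-mono-≼ (≼-refl {x}) 0≤z) (≈⇒≼ eq))
  where open ≈-Solver

≺-≼-trans : x ≺ y → y ≼ z → x ≺ z
≺-≼-trans h k l = h (≼-trans k l)

≼-≺-trans : x ≼ y → y ≺ z → x ≺ z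
≼-≺-trans h k l = k (≼-trans l h)

0≼y-x : x ≼ y → 0# ≼ y - x
0≼y-x {x} {y} h = ≼-trans (≈⇒≼ (solve 1 (λ x → con 0ℚ := x :- x) ≈-refl x))
  (+-mono-≼ h (≼-refl { - x}))
  where open ≈-Solver

0≺y-x : x ≺ y → 0# ≺ y - x
0≺y-x {x} {y} h k = h (≼-by _ (0≼y-x k)
  (solve 2 (λ x y → y :+ (con 0ℚ :- (y :- x)) := x) ≈-refl x y))
  where open ≈-Solver

≺-by : ∀ z → 0# ≺ z → x + z ≈ y → x ≺ y
≺-by {x} {y} z 0<z eq y≤x = 0<z (≼-by _ (0≼y-x y≤x)
    (≈-trans (+-cong (≈-refl {z}) (+-cong (≈-refl {x}) (-‿cong (≈-sym eq))))
      (solve 2 (λ z x → z :+ (x :- (x :+ z)) := con 0ℚ) ≈-refl z x)))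
  where open ≈-Solver

0≼x+y : 0# ≼ x → 0# ≼ y → 0# ≼ x + y
0≼x+y h k = ≼-trans h (≼-by _ k ≈-refl)

0≺x+y : 0# ≺ x → 0# ≼ y → 0# ≺ x + y
0≺x+y h k = ≺-≼-trans h (≼-by _ k ≈-refl)

0≺1 : 0# ≺ 1#
0≺1 = ⌜⌝-mono-< (ℚ.positive⁻¹ 1ℚ)

+-monoʳ-≼ : ∀ x → y ≼ z → x + y ≼ x + z
+-monoʳ-≼ x h = +-mono-≼ ≼-refl h

+-cancelʳ-≼ : ∀ z → x + z ≼ y + z → x ≼ y
+-cancelʳ-≼ {x} {y} z h = ≼-by _ (0≼y-x h)
  (solve 3 (λ x y z → x :+ ((y :+ z) :- (x :+ z)) := y) ≈-refl x y z)
  where open ≈-Solver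

-- Since `y ≺ x` is the negation of `x ≼ y`, a refutation of `C` turns `f` into the argument of `g`.
-- The order is thus total for every stable goal.
≼⊎≺ : ∀ x y {C : Set} → Stable C → (x ≼ y → C) → (y ≺ x → C) → C
≼⊎≺ x y stable f g = stable λ ¬c → ¬c (g λ x≤y → ¬c (f x≤y))

·-congˡ : ∀ z → x ≈ y → z · x ≈ z · y
·-congˡ z h = ·-cong ≈-refl h

x≈0⇒x·y≈0 : ∀ y → x ≈ 0# → x · y ≈ 0#
x≈0⇒x·y≈0 y h = ≈-trans (·-congʳ y h) (solve 1 (λ y → con 0ℚ :* y := con 0ℚ) ≈-refl y)
  where open ≈-Solver

y≈0⇒x·y≈0 : ∀ x → y ≈ 0# → x · y ≈ 0#
y≈0⇒x·y≈0 {y} x h = ≈-trans (·-comm x y) (x≈0⇒x·y≈0 x h)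

0≼x·y : 0# ≼ x → 0# ≼ y → 0# ≼ x · y
0≼x·y {x} {y} 0≤x 0≤y = ≼⊎≺ x 0# ≼-stable
  (λ x≤0 → ≈⇒≽ (x≈0⇒x·y≈0 y (≼-antisym x≤0 0≤x)))
  λ 0<x → ≼⊎≺ y 0# ≼-stable
    (λ y≤0 → ≈⇒≽ (y≈0⇒x·y≈0 x (≼-antisym y≤0 0≤y)))
    λ 0<y → ≺⇒≼ (0≺x·y 0<x 0<y)

·-monoˡ-≼ : 0# ≼ z → x ≼ y → z · x ≼ z · y
·-monoˡ-≼ {z} {x} {y} 0≤z h = ≼-by _ (0≼x·y 0≤z (0≼y-x h))
  (solve 3 (λ x y z → z :* x :+ z :* (y :- x) := z :* y) ≈-refl x y z)
  where open ≈-Solver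

·-monoˡ-≺ : 0# ≺ z → x ≺ y → z · x ≺ z · y
·-monoˡ-≺ {z} {x} {y} 0<z h = ≺-by _ (0≺x·y 0<z (0≺y-x h))
  (solve 3 (λ x y z → z :* x :+ z :* (y :- x) := z :* y) ≈-refl x y z)
  where open ≈-Solver

·-monoʳ-≼ : 0# ≼ z → x ≼ y → x · z ≼ y · z
·-monoʳ-≼ {z} {x} {y} 0≤z h =
  ≼-trans (≈⇒≼ (·-comm x z)) (≼-trans (·-monoˡ-≼ 0≤z h) (≈⇒≼ (·-comm z y)))

·-cancelˡ-≼ : 0# ≺ z → z · x ≼ z · y → x ≼ y
·-cancelˡ-≼ 0<z h = ≼-stable λ y<x → ·-monoˡ-≺ 0<z y<x h

·-cancelˡ-≈ : 0# ≺ z → z · x ≈ z · y → x ≈ y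
·-cancelˡ-≈ 0<z h = ≼-antisym (·-cancelˡ-≼ 0<z (≈⇒≼ h)) (·-cancelˡ-≼ 0<z (≈⇒≽ h))

private
  neg-square : ∀ x → (0# - x) · (0# - x) ≈ x · x
  neg-square = solve 1 (λ x → (con 0ℚ :- x) :* (con 0ℚ :- x) := x :* x) ≈-refl
    where open ≈-Solver

0≼x² : ∀ x → 0# ≼ x · x
0≼x² x = ≼⊎≺ 0# x ≼-stable (λ h → 0≼x·y h h) λ x<0 →
  ≼-trans (≺⇒≼ (0≺x·y (0≺y-x x<0) (0≺y-x x<0))) (≈⇒≼ (neg-square x))

x²≼0⇒x≈0 : x · x ≼ 0# → x ≈ 0#
x²≼0⇒x≈0 {x} h = ≼-antisym (≼-stable λ 0<x → 0≺x·y 0<x 0<x h)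
  (≼-stable λ x<0 → 0≺x·y (0≺y-x x<0) (0≺y-x x<0) (≼-trans (≈⇒≼ (neg-square x)) h))


-- Finite sums

opaque

  sum : ∀ {n} → (Fin n → ℝ) → ℝ
  sum = ∑.sum

  sum-zero : ∀ (f : Fin 0 → ℝ) → sum f ≈ 0#
  sum-zero f = ≈-refl

  sum-suc : ∀ {n} (f : Fin (suc n) → ℝ) → sum f ≈ f zero + sum (f ∘ suc)
  sum-suc f = ≈-refl

  sum-cong : ∀ {n} {f g : Fin n → ℝ} → (∀ i → f i ≈ g i) → sum f ≈ sum g
  sum-cong = ∑.sum-cong-≋

  sum-+ : ∀ {n} (f g : Fin n → ℝ) → sum (λ i → f i + g i) ≈ sum f + sum g
  sum-+ = ∑.∑-distrib-+

  sum-comm : ∀ {m n} (f : Fin m → Fin n → ℝ) → sum (λ i → sum (f i)) ≈ sum (λ j → sum (λ i → f i j))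
  sum-comm = ∑.∑-comm

  sum-permute : ∀ {m n} (f : Fin n → ℝ) (π : Permutation m n) → sum f ≈ sum (λ i → f (π ⟨$⟩ʳ i))
  sum-permute = ∑.sum-permute

  ·-sum : ∀ {n} x (f : Fin n → ℝ) → x · sum f ≈ sum (λ i → x · f i)
  ·-sum = ∑.*-distribˡ-sum

sum-mono-≼ : ∀ {n} {f g : Fin n → ℝ} → (∀ i → f i ≼ g i) → sum f ≼ sum g
sum-mono-≼ {zero} {f} {g} h = ≈⇒≼ (≈-trans (sum-zero f) (≈-sym (sum-zero g)))
sum-mono-≼ {suc n} {f} {g} h = ≼-trans (≈⇒≼ (sum-suc f))
  (≼-trans (+-mono-≼ (h zero) (sum-mono-≼ (h ∘ suc))) (≈⇒≽ (sum-suc g)))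

-- The other terms of `f` are dominated by those of `g`, so cancelling them from the inequality of
-- sums leaves the reverse inequality for a single term. Both equality cases rest on this.
sum-mono-≼-tight : ∀ {n} {f g : Fin n → ℝ} → (∀ i → f i ≼ g i) → sum g ≼ sum f → ∀ i → g i ≼ f i
sum-mono-≼-tight {suc n} {f} {g} h k = λ { zero → head ; (suc i) → sum-mono-≼-tight (h ∘ suc) tail i }
  where
  k′ : g zero + sum (g ∘ suc) ≼ f zero + sum (f ∘ suc)
  k′ = ≼-trans (≈⇒≽ (sum-suc g)) (≼-trans k (≈⇒≼ (sum-suc f)))
  head : g zero ≼ f zero
  head = +-cancelʳ-≼ (sum (f ∘ suc)) (≼-trans (+-monoʳ-≼ (g zero) (sum-mono-≼ (h ∘ suc))) k′)
  tail : sum (g ∘ suc) ≼ sum (f ∘ suc)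
  tail = +-cancelʳ-≼ (g zero) (≼-trans (≈⇒≼ (+-comm _ _))
    (≼-trans k′ (≼-trans (≈⇒≼ (+-comm _ _)) (+-monoʳ-≼ _ (h zero)))))

0≼sum : ∀ {n} {f : Fin n → ℝ} → (∀ i → 0# ≼ f i) → 0# ≼ sum f
0≼sum {zero} {f} h = ≈⇒≽ (sum-zero f)
0≼sum {suc n} {f} h = ≼-trans (0≼x+y (h zero) (0≼sum (h ∘ suc))) (≈⇒≽ (sum-suc f))

0≼sum-tight : ∀ {n} {f : Fin n → ℝ} → (∀ i → 0# ≼ f i) → sum f ≼ 0# → ∀ i → f i ≼ 0#
0≼sum-tight {n} {f} h k = sum-mono-≼-tight h (≼-trans k (0≼sum {n} {λ _ → 0#} λ _ → ≼-refl))

-- Sorting and the Rayleigh quotient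

argmin : ∀ {n} (k : Fin (suc n) → ℝ) → DoubleNegation (∃[ i ] ∀ j → k i ≼ k j)
argmin {zero} k h = h (zero , λ { zero → ≼-refl })
argmin {suc n} k h = argmin (k ∘ suc) λ (i , min) → ≼⊎≺ (k zero) (k (suc i)) (λ f → f id)
  (λ k₀≼ → h (zero , λ { zero → ≼-refl ; (suc j) → ≼-trans k₀≼ (min j) }))
  (λ ≺k₀ → h (suc i , λ { zero → ≺⇒≼ ≺k₀ ; (suc j) → min j }))

-- Selection sort: a transposition brings a minimum to the front. The minimum exists only under a
-- double negation, and so does the permutation.
sort : ∀ {n} (k : Fin n → ℝ) →
  DoubleNegation (∃[ π ] ∀ i j → i Fin.≤ j → k (π ⟨$⟩ʳ i) ≼ k ((Permutation n n ∋ π) ⟨$⟩ʳ j))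
sort {zero} k h = h (Perm.id , λ ())
sort {suc n} k h = argmin k λ (i₀ , min) → let τ = transpose zero i₀ in
  sort (λ i → k (τ ⟨$⟩ʳ suc i)) λ (π , sorted) → h (lift₀ π ∘ₚ τ , λ where
    zero    j       _         → min _
    (suc i) (suc j) (s≤s i≤j) → sorted i j i≤j)

-- `p i` is the product of the other entries. It replaces the reciprocal, whose convergence would
-- take an explicit positive lower bound that the negative relation `_≺_` does not provide.
cofactors : ∀ {n} (v : Fin n → ℝ) → (∀ i → 0# ≺ v i) →
  ∃[ P ] 0# ≺ P × Σ (Fin n → ℝ) λ p → ∀ i → v i · p i ≈ P
cofactors {zero} v 0≺v = 1# , 0≺1 , (λ ()) , λ ()
cofactors {suc n} v 0≺v with cofactors (v ∘ suc) (0≺v ∘ suc)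
... | P , 0≺P , p , vp = v zero · P , 0≺x·y (0≺v zero) 0≺P
  , (λ { zero → P ; (suc i) → v zero · p i })
  , λ { zero → ≈-refl ; (suc i) → ≈-trans
          (solve 3 (λ a b c → a :* (b :* c) := b :* (a :* c)) ≈-refl (v (suc i)) (v zero) (p i))
          (·-congˡ (v zero) (vp i)) }
  where open ≈-Solver

quadratic : ∀ {m} → (Fin m → Fin m → ℝ) → (Fin m → ℝ) → ℝ
quadratic a y = sum λ s → sum λ t → a s t · (y s · y t)

norm² : ∀ {m} → (Fin m → ℝ) → ℝ
norm² y = sum λ s → y s · y s

-- With y s = τ s · v s, the bound is a weighted sum of the inequalities 2 τ s τ t ≤ (τ s)² + (τ t)².
-- The quotient τ s = y s / v s is scaled by the product P of all v s, so that no division occurs.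
module Rayleigh {m} (a : Fin m → Fin m → ℝ) (a-sym : ∀ s t → a s t ≈ a t s)
  (0≼a : ∀ s t → 0# ≼ a s t) (v : Fin m → ℝ) (0≺v : ∀ s → 0# ≺ v s) (ρ : ℝ)
  (eigen : ∀ s → sum (λ t → a s t · v t) ≈ ρ · v s) (y : Fin m → ℝ) where

  open ≈-Solver using (solve; _:+_; _:*_; _:-_; _:=_)
  open import Relation.Binary.Reasoning.Setoid (CommutativeRing.setoid ℝ-commutativeRing)

  P : ℝ
  P = proj₁ (cofactors v 0≺v)

  0≺P : 0# ≺ P
  0≺P = proj₁ (proj₂ (cofactors v 0≺v))

  p : Fin m → ℝ
  p = proj₁ (proj₂ (proj₂ (cofactors v 0≺v)))

  vp : ∀ s → v s · p s ≈ P
  vp = proj₂ (proj₂ (proj₂ (cofactors v 0≺v)))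

  τ : Fin m → ℝ
  τ s = y s · p s

  vτ : ∀ s → v s · τ s ≈ P · y s
  vτ s = ≈-trans (solve 3 (λ v y p → v :* (y :* p) := (v :* p) :* y) ≈-refl (v s) (y s) (p s))
    (·-congʳ (y s) (vp s))

  c : Fin m → Fin m → ℝ
  c s t = a s t · (v s · v t)

  0≼c : ∀ s t → 0# ≼ c s t
  0≼c s t = 0≼x·y (0≼a s t) (0≼x·y (≺⇒≼ (0≺v s)) (≺⇒≼ (0≺v t)))

  cross square : Fin m → Fin m → ℝ
  cross s t = c s t · (τ s · τ t) + c s t · (τ s · τ t)
  square s t = c s t · (τ s · τ s) + c s t · (τ t · τ t)

  square-cross : ∀ s t → cross s t + c s t · ((τ s - τ t) · (τ s - τ t)) ≈ square s t
  square-cross s t = solve 3 (λ c x y → (c :* (x :* y) :+ c :* (x :* y)) :+ c :* ((x :- y) :* (x :- y))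
    := c :* (x :* x) :+ c :* (y :* y)) ≈-refl (c s t) (τ s) (τ t)

  cross≼square : ∀ s t → cross s t ≼ square s t
  cross≼square s t = ≼-by _ (0≼x·y (0≼c s t) (0≼x² _)) (square-cross s t)

  sum-cross : sum (λ s → sum (cross s)) ≈ (P · P) · quadratic a y + (P · P) · quadratic a y
  sum-cross = begin
    sum (λ s → sum (cross s))
      ≈⟨ sum-cong (λ s → ≈-trans (sum-+ _ _)
           (+-cong (half s) (half s))) ⟩
    sum (λ s → (P · P) · sum (λ t → a s t · (y s · y t)) + (P · P) · sum (λ t → a s t · (y s · y t)))
      ≈⟨ sum-+ _ _ ⟩
    sum (λ s → (P · P) · sum (λ t → a s t · (y s · y t)))
      + sum (λ s → (P · P) · sum (λ t → a s t · (y s · y t)))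
      ≈⟨ +-cong (·-sum (P · P) _) (·-sum (P · P) _) ⟨
    (P · P) · quadratic a y + (P · P) · quadratic a y ∎
    where
    term : ∀ s t → c s t · (τ s · τ t) ≈ (P · P) · (a s t · (y s · y t))
    term s t = begin
      c s t · (τ s · τ t)
        ≈⟨ solve 5 (λ a v w x y → a :* (v :* w) :* (x :* y) := a :* ((v :* x) :* (w :* y))) ≈-refl
             (a s t) (v s) (v t) (τ s) (τ t) ⟩
      a s t · ((v s · τ s) · (v t · τ t)) ≈⟨ ·-congˡ _ (·-cong (vτ s) (vτ t)) ⟩
      a s t · ((P · y s) · (P · y t))
        ≈⟨ solve 4 (λ a P x y → a :* ((P :* x) :* (P :* y)) := (P :* P) :* (a :* (x :* y))) ≈-refl
             (a s t) P (y s) (y t) ⟩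
      (P · P) · (a s t · (y s · y t)) ∎
    half : ∀ s → sum (λ t → c s t · (τ s · τ t)) ≈ (P · P) · sum (λ t → a s t · (y s · y t))
    half s = ≈-trans (sum-cong (term s)) (≈-sym (·-sum (P · P) _))

  -- Summed over `t`, the weights `c s t` become ρ (v s)² by the eigenvalue equation, and v s · τ s
  -- is P · y s. The two halves agree by symmetry of `a`.
  sum-square : sum (λ s → sum (square s)) ≈ (P · P) · (ρ · norm² y) + (P · P) · (ρ · norm² y)
  sum-square = begin
    sum (λ s → sum (square s))
      ≈⟨ sum-cong (λ s → sum-+ _ _) ⟩
    sum (λ s → sum (left s) + sum (λ t → c s t · (τ t · τ t)))
      ≈⟨ sum-+ _ _ ⟩
    sum (λ s → sum (left s)) + sum (λ s → sum (λ t → c s t · (τ t · τ t)))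
      ≈⟨ +-cong ≈-refl (≈-trans (sum-comm _) (sum-cong λ s → sum-cong λ t →
           ·-congʳ _ (·-cong (a-sym t s) (·-comm (v t) (v s))))) ⟩
    sum (λ s → sum (left s)) + sum (λ s → sum (left s))
      ≈⟨ +-cong sum-left sum-left ⟩
    (P · P) · (ρ · norm² y) + (P · P) · (ρ · norm² y) ∎
    where
    left : Fin m → Fin m → ℝ
    left s t = c s t · (τ s · τ s)
    row : ∀ s → sum (left s) ≈ ((P · P) · ρ) · (y s · y s)
    row s = begin
      sum (left s)
        ≈⟨ sum-cong (λ t → solve 4 (λ a v w x → a :* (v :* w) :* (x :* x) := (v :* (x :* x)) :* (a :* w))
             ≈-refl (a s t) (v s) (v t) (τ s)) ⟩
      sum (λ t → (v s · (τ s · τ s)) · (a s t · v t)) ≈⟨ ·-sum _ _ ⟨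
      (v s · (τ s · τ s)) · sum (λ t → a s t · v t)   ≈⟨ ·-congˡ _ (eigen s) ⟩
      (v s · (τ s · τ s)) · (ρ · v s)
        ≈⟨ solve 3 (λ v x r → v :* (x :* x) :* (r :* v) := r :* ((v :* x) :* (v :* x))) ≈-refl
             (v s) (τ s) ρ ⟩
      ρ · ((v s · τ s) · (v s · τ s)) ≈⟨ ·-congˡ _ (·-cong (vτ s) (vτ s)) ⟩
      ρ · ((P · y s) · (P · y s))
        ≈⟨ solve 3 (λ r P y → r :* ((P :* y) :* (P :* y)) := ((P :* P) :* r) :* (y :* y)) ≈-refl ρ P (y s) ⟩
      ((P · P) · ρ) · (y s · y s) ∎
    sum-left : sum (λ s → sum (left s)) ≈ (P · P) · (ρ · norm² y)
    sum-left = begin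
      sum (λ s → sum (left s))                  ≈⟨ sum-cong row ⟩
      sum (λ s → ((P · P) · ρ) · (y s · y s))   ≈⟨ ·-sum _ _ ⟨
      ((P · P) · ρ) · norm² y                   ≈⟨ ·-assoc _ _ _ ⟩
      (P · P) · (ρ · norm² y) ∎

  0≺PP : 0# ≺ P · P
  0≺PP = 0≺x·y 0≺P 0≺P

  x+x-mono⁻¹ : ∀ {x y} → x + x ≼ y + y → x ≼ y
  x+x-mono⁻¹ {x} {y} h = ≼-stable λ y<x → ≺-by _ (0≺x+y (0≺y-x y<x) (≺⇒≼ (0≺y-x y<x)))
    (solve 2 (λ x y → (y :+ y) :+ ((x :- y) :+ (x :- y)) := x :+ x) ≈-refl x y) h

  bound : quadratic a y ≼ ρ · norm² y
  bound = ·-cancelˡ-≼ 0≺PP (x+x-mono⁻¹ (≼-trans (≈⇒≽ sum-cross)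
    (≼-trans (sum-mono-≼ λ s → sum-mono-≼ (cross≼square s)) (≈⇒≼ sum-square))))

  -- Up to a positive factor, the two sides of `bound` differ by the sum of all c s t (τ s - τ t)².
  -- Equality makes each term vanish, so τ is constant along every edge.
  tight : ρ · norm² y ≼ quadratic a y → ∀ s t → 0# ≺ a s t → y s · v t ≈ y t · v s
  tight h s t 0≺a = ·-cancelˡ-≈ 0≺P (begin
      P · (y s · v t)     ≈⟨ ·-assoc _ _ _ ⟨
      (P · y s) · v t     ≈⟨ ·-congʳ _ (vτ s) ⟨
      (v s · τ s) · v t   ≈⟨ ·-congʳ _ (·-congˡ _ τs≈τt) ⟩
      (v s · τ t) · v t   ≈⟨ solve 3 (λ v x w → (v :* x) :* w := (w :* x) :* v) ≈-refl (v s) (τ t) (v t) ⟩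
      (v t · τ t) · v s   ≈⟨ ·-congʳ _ (vτ t) ⟩
      (P · y t) · v s     ≈⟨ ·-assoc _ _ _ ⟩
      P · (y t · v s) ∎)
    where
    sums : sum (λ s → sum (square s)) ≼ sum (λ s → sum (cross s))
    sums = ≼-trans (≈⇒≼ sum-square) (≼-trans (+-mono-≼ (·-monoˡ-≼ (≺⇒≼ 0≺PP) h) (·-monoˡ-≼ (≺⇒≼ 0≺PP) h))
      (≈⇒≽ sum-cross))
    square≼cross : square s t ≼ cross s t
    square≼cross = sum-mono-≼-tight (cross≼square s)
      (sum-mono-≼-tight (λ s → sum-mono-≼ (cross≼square s)) sums s) t
    0≺c : 0# ≺ c s t
    0≺c = 0≺x·y 0≺a (0≺x·y (0≺v s) (0≺v t))
    c·0≼0 : c s t · ((τ s - τ t) · (τ s - τ t)) ≼ c s t · 0#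
    c·0≼0 = +-cancelʳ-≼ (cross s t) (≼-trans (≈⇒≼ (≈-trans (+-comm _ _) (square-cross s t)))
      (≼-trans square≼cross (≈⇒≼ (solve 2 (λ x c → x := c :* con 0ℚ :+ x) ≈-refl (cross s t) (c s t)))))
      where open ≈-Solver using (con)
    τs≈τt : τ s ≈ τ t
    τs≈τt = begin
      τ s               ≈⟨ solve 2 (λ x y → x := (x :- y) :+ y) ≈-refl (τ s) (τ t) ⟩
      (τ s - τ t) + τ t ≈⟨ +-cong (x²≼0⇒x≈0 (·-cancelˡ-≼ 0≺c c·0≼0)) ≈-refl ⟩
      0# + τ t          ≈⟨ +-identityˡ _ ⟩
      τ t ∎

-- Bisection

suc/1 : ℕ → ℚ
suc/1 n = mkℚ (+ suc n) 0 (Coprimality.sym (Coprimality.1-coprimeTo (suc n)))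

½*suc/1 : ∀ n → ½ ℚ.* suc/1 (suc n) ℚ.≤ suc/1 n
½*suc/1 n = ℚ.toℚᵘ-cancel-≤ (ℚᵘ.≤-respˡ-≃ (ℚᵘ.≃-sym (ℚ.toℚᵘ-homo-* ½ (suc/1 (suc n))))
  (ℚᵘ.*≤* (ℤ.+≤+ (bound n))))
  where
  open ℕ.≤-Reasoning
  bound : ∀ n → suc (suc (n ℕ.+ 0)) ℕ.* 1 ℕ.≤ suc n ℕ.* 2
  bound n = begin
    suc (suc (n ℕ.+ 0)) ℕ.* 1 ≡⟨ ℕ.*-identityʳ _ ⟩
    suc (suc (n ℕ.+ 0))       ≡⟨ cong (λ k → suc (suc k)) (ℕ.+-identityʳ n) ⟩
    suc (suc n)               ≤⟨ s≤s (s≤s (ℕ.m≤m*n n 2)) ⟩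
    suc n ℕ.* 2               ∎

archimedean : ∀ p → ∃[ n ] p ℚ.≤ suc/1 n
archimedean (mkℚ (+ n) d _) = n , ℚ.*≤* (subst₂ ℤ._≤_ (ℤ.pos-* n 1) (ℤ.pos-* (suc n) (suc d))
  (ℤ.+≤+ (ℕ.*-mono-≤ (ℕ.n≤1+n n) (s≤s (z≤n {d})))))
archimedean (mkℚ -[1+ n ] d _) = 0 , ℚ.*≤* ℤ.-≤+

p≤p+q : ∀ {p q} → 0ℚ ℚ.≤ q → p ℚ.≤ p ℚ.+ q
p≤p+q {p} {q} 0≤q = ≤-by-ℚ q 0≤q refl

-- The invariant is `¬ A` at `lo` and `A` at `hi`, so the common limit is approached through points
-- of both kinds. Decidability of `A` at rationals makes each halving effective.
module Bisection (A : ℚ → Set) (A? : ∀ q → Dec (A q))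
  (l₀ h₀ : ℚ) (l₀≤h₀ : l₀ ℚ.≤ h₀) (¬Al₀ : ¬ A l₀) (Ah₀ : A h₀) where

  open +-*-Solver

  record Bracket : Set where
    field
      lo hi : ℚ
      lo≤hi : lo ℚ.≤ hi
      ¬Alo : ¬ A lo
      Ahi : A hi

    width : ℚ
    width = hi ℚ.- lo

    mid : ℚ
    mid = lo ℚ.+ ½ ℚ.* width

    0≤½width : 0ℚ ℚ.≤ ½ ℚ.* width
    0≤½width = 0≤* (ℚ.<⇒≤ 0<½) (p≤q⇒0≤q-p lo≤hi)

    mid≤hi : mid ℚ.≤ hi
    mid≤hi = ≤-by-ℚ (½ ℚ.* width) 0≤½width
      (solve 2 (λ l h → (l :+ con ½ :* (h :- l)) :+ con ½ :* (h :- l) := h) refl lo hi)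

  open Bracket

  record Refines (b b′ : Bracket) : Set where
    field
      lo-mono : lo b ℚ.≤ lo b′
      hi-anti : hi b′ ℚ.≤ hi b
      halved  : width b′ ≡ ½ ℚ.* width b

  open Refines

  bisect : ∀ b → ∃[ b′ ] Refines b b′
  bisect b with A? (mid b)
  ... | yes Am = record { lo = lo b ; hi = mid b ; lo≤hi = p≤p+q (0≤½width b) ; ¬Alo = ¬Alo b ; Ahi = Am }
    , record { lo-mono = ℚ.≤-refl ; hi-anti = mid≤hi b
             ; halved = solve 2 (λ l h → (l :+ con ½ :* (h :- l)) :- l := con ½ :* (h :- l)) refl (lo b) (hi b) }
  ... | no ¬Am = record { lo = mid b ; hi = hi b ; lo≤hi = mid≤hi b ; ¬Alo = ¬Am ; Ahi = Ahi b }
    , record { lo-mono = p≤p+q (0≤½width b) ; hi-anti = ℚ.≤-refl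
             ; halved = solve 2 (λ l h → h :- (l :+ con ½ :* (h :- l)) := con ½ :* (h :- l)) refl (lo b) (hi b) }

  bracket : ℕ → Bracket
  bracket zero = record { lo = l₀ ; hi = h₀ ; lo≤hi = l₀≤h₀ ; ¬Alo = ¬Al₀ ; Ahi = Ah₀ }
  bracket (suc n) = proj₁ (bisect (bracket n))

  step : ∀ n → Refines (bracket n) (bracket (suc n))
  step n = proj₂ (bisect (bracket n))

  nested : ∀ {m n} → m ℕ.≤′ n → lo (bracket m) ℚ.≤ lo (bracket n) × hi (bracket n) ℚ.≤ hi (bracket m)
  nested ℕ.≤′-refl = ℚ.≤-refl , ℚ.≤-refl
  nested {n = suc n} (ℕ.≤′-step m≤n) =
      ℚ.≤-trans (proj₁ (nested m≤n)) (lo-mono (step n))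
    , ℚ.≤-trans (hi-anti (step n)) (proj₂ (nested m≤n))

  w : ℕ → ℚ
  w n = width (bracket n)

  0≤w : ∀ n → 0ℚ ℚ.≤ w n
  0≤w n = p≤q⇒0≤q-p (lo≤hi (bracket n))

  -- A linear rate replaces the exponential one: halving the width outweighs the growth of the
  -- factor from n + 1 to n + 2.
  w-bound : ∀ n → w n ℚ.* suc/1 n ℚ.≤ w 0
  w-bound zero = ℚ.≤-reflexive (ℚ.*-identityʳ (w 0))
  w-bound (suc n) = begin
    w (suc n) ℚ.* suc/1 (suc n)     ≡⟨ cong (ℚ._* suc/1 (suc n)) (halved (step n)) ⟩
    ½ ℚ.* w n ℚ.* suc/1 (suc n)     ≡⟨ solve 3 (λ h w k → h :* w :* k := w :* (h :* k)) refl ½ (w n) (suc/1 (suc n)) ⟩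
    w n ℚ.* (½ ℚ.* suc/1 (suc n))   ≤⟨ ℚ.*-monoˡ-≤-nonNeg (w n) {{ℚ.nonNegative (0≤w n)}} (½*suc/1 n) ⟩
    w n ℚ.* suc/1 n                 ≤⟨ w-bound n ⟩
    w 0                             ∎
    where open ℚ.≤-Reasoning

  w-small : ∀ ε → 0ℚ ℚ.< ε → ∃[ N ] w N ℚ.≤ ε
  w-small ε 0<ε = N , ℚ.*-cancelʳ-≤-pos (suc/1 N) (begin
    w N ℚ.* suc/1 N         ≤⟨ w-bound N ⟩
    w 0                     ≡⟨ ℚ.*-identityˡ (w 0) ⟨
    1ℚ ℚ.* w 0              ≡⟨ cong (ℚ._* w 0) (ℚ.*-inverseʳ ε) ⟨
    ε ℚ.* 1/ε ℚ.* w 0       ≡⟨ ℚ.*-assoc ε 1/ε (w 0) ⟩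
    ε ℚ.* (1/ε ℚ.* w 0)     ≤⟨ ℚ.*-monoˡ-≤-nonNeg ε {{ℚ.pos⇒nonNeg ε}} (proj₂ (archimedean (1/ε ℚ.* w 0))) ⟩
    ε ℚ.* suc/1 N           ∎)
    where
    open ℚ.≤-Reasoning
    instance
      _ = ℚ.positive 0<ε
      _ = ℚ.pos⇒nonZero ε
    1/ε = ℚ.1/ ε
    N = proj₁ (archimedean (1/ε ℚ.* w 0))

  close : ∀ {p q} n → lo (bracket n) ℚ.≤ p → p ℚ.≤ hi (bracket n) →
    lo (bracket n) ℚ.≤ q → q ℚ.≤ hi (bracket n) → ∣ p ℚ.- q ∣ ℚ.≤ w n
  close {p} {q} n l≤p p≤h l≤q q≤h = ∣p-q∣≤r (within l≤q p≤h) (within l≤p q≤h)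
    where
    within : ∀ {p q} → lo (bracket n) ℚ.≤ p → q ℚ.≤ hi (bracket n) → q ℚ.≤ p ℚ.+ w n
    within {p} {q} l≤p q≤h = ≤-by-ℚ _ (0≤+ (p≤q⇒0≤q-p l≤p) (p≤q⇒0≤q-p q≤h))
      (solve 4 (λ l h p q → q :+ ((p :- l) :+ (h :- q)) := p :+ (h :- l)) refl
        (lo (bracket n)) (hi (bracket n)) p q)

  inside : (x : Bracket → ℚ) → (∀ b → lo b ℚ.≤ x b) → (∀ b → x b ℚ.≤ hi b) → ∀ {N n} → N ℕ.≤ n →
    lo (bracket N) ℚ.≤ x (bracket n) × x (bracket n) ℚ.≤ hi (bracket N)
  inside x l≤x x≤h {N} {n} N≤n =
      ℚ.≤-trans (proj₁ (nested (ℕ.≤⇒≤′ N≤n))) (l≤x (bracket n))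
    , ℚ.≤-trans (x≤h (bracket n)) (proj₂ (nested (ℕ.≤⇒≤′ N≤n)))

  limit : (x : Bracket → ℚ) → (∀ b → lo b ℚ.≤ x b) → (∀ b → x b ℚ.≤ hi b) → ℝ
  limit x l≤x x≤h = mkℝ (λ n → x (bracket n)) λ ε 0<ε → let N , w≤ε = w-small ε 0<ε in
    N , λ m n N≤m N≤n → ℚ.≤-trans (close N
      (proj₁ (inside x l≤x x≤h N≤m)) (proj₂ (inside x l≤x x≤h N≤m))
      (proj₁ (inside x l≤x x≤h N≤n)) (proj₂ (inside x l≤x x≤h N≤n))) w≤ε

  lower upper : ℝ
  lower = limit lo (λ b → ℚ.≤-refl) lo≤hi
  upper = limit hi lo≤hi (λ b → ℚ.≤-refl)

  lower≈upper : lower ≈ upper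
  lower≈upper = ≃⇒≈ λ ε 0<ε → let N , w≤ε = w-small ε 0<ε in
    N , λ n N≤n → ℚ.≤-trans (close N
      (proj₁ (inside lo (λ b → ℚ.≤-refl) lo≤hi N≤n)) (proj₂ (inside lo (λ b → ℚ.≤-refl) lo≤hi N≤n))
      (proj₁ (inside hi lo≤hi (λ b → ℚ.≤-refl) N≤n)) (proj₂ (inside hi lo≤hi (λ b → ℚ.≤-refl) N≤n))) w≤ε

  ¬A-lower : ∀ n → ¬ A (seq lower n)
  ¬A-lower n = ¬Alo (bracket n)

  A-upper : ∀ n → A (seq upper n)
  A-upper n = Ahi (bracket n)

  l₀≤lower : ∀ n → l₀ ℚ.≤ seq lower n
  l₀≤lower n = proj₁ (nested (ℕ.≤⇒≤′ (z≤n {n})))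

-- The Perron vector of G(2n,1)

-- The eigenvector of G(2n,1) is built from its last pair of coordinates u = w = 1 downwards:
-- up to powers of r(r + 1), U r k and W r k are the coordinates k places before the last pair,
-- and D r k is the defect of the eigenvalue equations when the vector stops there.

U W D : ℝ → ℕ → ℝ
U r zero    = 1#
U r (suc k) = (r + 1#) · D r k
W r zero    = 1#
W r (suc k) = r · (r + 1#) · W r k + D r k
D r k       = r · U r k - W r k

-- The same recursion over ℚ, where positivity is decidable. Its values at `seq r n` are the
-- approximants of the real recursion, so the bisection can test rational points.
Uℚ Wℚ Dℚ : ℚ → ℕ → ℚ
Uℚ q zero    = 1ℚ
Uℚ q (suc k) = (q ℚ.+ 1ℚ) ℚ.* Dℚ q k
Wℚ q zero    = 1ℚ
Wℚ q (suc k) = q ℚ.* (q ℚ.+ 1ℚ) ℚ.* Wℚ q k ℚ.+ Dℚ q k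
Dℚ q k       = q ℚ.* Uℚ q k ℚ.- Wℚ q k

opaque
  unfolding ⌜_⌝

  seq-U : ∀ r k n → seq (U r k) n ≡ Uℚ (seq r n) k
  seq-W : ∀ r k n → seq (W r k) n ≡ Wℚ (seq r n) k
  seq-D : ∀ r k n → seq (D r k) n ≡ Dℚ (seq r n) k
  seq-U r zero    n = refl
  seq-U r (suc k) n = cong ((seq r n ℚ.+ 1ℚ) ℚ.*_) (seq-D r k n)
  seq-W r zero    n = refl
  seq-W r (suc k) n = cong₂ (λ a b → seq r n ℚ.* (seq r n ℚ.+ 1ℚ) ℚ.* a ℚ.+ b) (seq-W r k n) (seq-D r k n)
  seq-D r k       n = cong₂ (λ a b → seq r n ℚ.* a ℚ.- b) (seq-U r k n) (seq-W r k n)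

U-cong : ∀ {r s} → r ≈ s → ∀ k → U r k ≈ U s k
W-cong : ∀ {r s} → r ≈ s → ∀ k → W r k ≈ W s k
D-cong : ∀ {r s} → r ≈ s → ∀ k → D r k ≈ D s k
U-cong h zero    = ≈-refl
U-cong h (suc k) = ·-cong (+-cong h ≈-refl) (D-cong h k)
W-cong h zero    = ≈-refl
W-cong h (suc k) = +-cong (·-cong (·-cong h (+-cong h ≈-refl)) (W-cong h k)) (D-cong h k)
D-cong h k       = +-cong (·-cong h (U-cong h k)) (-‿cong (W-cong h k))

-- All earlier defects are required to be positive too: a sign change of the last one alone could
-- occur at a smaller root, where the coordinates need not be positive.
Supercritical : ℕ → ℚ → Set
Supercritical zero    q = ⊤
Supercritical (suc k) q = Supercritical k q × 0ℚ ℚ.< Dℚ q k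

supercritical? : ∀ k q → Dec (Supercritical k q)
supercritical? zero    q = yes tt
supercritical? (suc k) q = supercritical? k q ×-dec (0ℚ ℚ.<? Dℚ q k)

-- `Dℚ 1ℚ 0` already vanishes: 1 is the spectral radius of a single edge, which is G(2,1).
supercritical-1 : ∀ k → ¬ Supercritical (suc k) 1ℚ
supercritical-1 zero    (_ , 0<0) = ℚ.<-irrefl refl 0<0
supercritical-1 (suc k) (s , _)   = supercritical-1 k s

private
  Large : ℕ → ℚ → ℚ → Set
  Large k R q = 1ℚ ℚ.≤ q × 0ℚ ℚ.< Uℚ q k × Wℚ q k ℚ.≤ R ℚ.* Uℚ q k × Supercritical k q

  -- The induction carries a ratio bound W ≤ R U uniform in q. Once q ≥ 2R, the defect is at least q
  -- U / 2, hence positive, and the next ratio is at most 2R + 1.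
  large : ∀ k → ∃[ H ] ∃[ R ] 0ℚ ℚ.≤ R × ∀ q → H ℚ.≤ q → Large k R q
  large zero = 1ℚ , 1ℚ , ℚ.<⇒≤ (ℚ.positive⁻¹ 1ℚ) , λ q 1≤q → 1≤q , ℚ.positive⁻¹ 1ℚ , ℚ.≤-refl , tt
  large (suc k) with large k
  ... | H , R , 0≤R , ih = H ℚ.⊔ (R ℚ.+ R) , (R ℚ.+ R) ℚ.+ 1ℚ
      , 0≤+ (0≤+ 0≤R 0≤R) (ℚ.<⇒≤ (ℚ.positive⁻¹ 1ℚ))
      , λ q H⊔2R≤q → next q (ih q (ℚ.≤-trans (ℚ.p≤p⊔q H (R ℚ.+ R)) H⊔2R≤q))
                            (ℚ.≤-trans (ℚ.p≤q⊔p H (R ℚ.+ R)) H⊔2R≤q)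
    where
    open +-*-Solver
    next : ∀ q → Large k R q → R ℚ.+ R ℚ.≤ q → Large (suc k) (R ℚ.+ R ℚ.+ 1ℚ) q
    next q (1≤q , 0<U , W≤RU , s) 2R≤q = 1≤q , 0<* 0<q+1 0<D , W≤ , s , 0<D
      where
      0<q : 0ℚ ℚ.< q
      0<q = ℚ.<-≤-trans (ℚ.positive⁻¹ 1ℚ) 1≤q
      0<q+1 : 0ℚ ℚ.< q ℚ.+ 1ℚ
      0<q+1 = ℚ.+-mono-< 0<q (ℚ.positive⁻¹ 1ℚ)
      u = Uℚ q k
      v = Wℚ q k
      d = Dℚ q k
      qu≤2d : q ℚ.* u ℚ.≤ d ℚ.+ d
      qu≤2d = ≤-by-ℚ _ (0≤+ (0≤+ (p≤q⇒0≤q-p W≤RU) (p≤q⇒0≤q-p W≤RU)) (0≤* (p≤q⇒0≤q-p 2R≤q) (ℚ.<⇒≤ 0<U)))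
        (solve 4 (λ q u v R → q :* u :+ (((R :* u :- v) :+ (R :* u :- v)) :+ (q :- (R :+ R)) :* u)
          := (q :* u :- v) :+ (q :* u :- v)) refl q u v R)
      0<D : 0ℚ ℚ.< d
      0<D = subst (0ℚ ℚ.<_) (trans (sym (ℚ.*-distribʳ-+ d ½ ½) ) (ℚ.*-identityˡ d))
        (subst (0ℚ ℚ.<_) (ℚ.*-distribˡ-+ ½ d d) (0<* 0<½ (ℚ.<-≤-trans (0<* 0<q 0<U) qu≤2d)))
      W≤ : Wℚ q (suc k) ℚ.≤ (R ℚ.+ R ℚ.+ 1ℚ) ℚ.* Uℚ q (suc k)
      W≤ = ≤-by-ℚ _ (0≤+ (0≤+ (0≤* (0≤* (ℚ.<⇒≤ 0<q) (ℚ.<⇒≤ 0<q+1)) (p≤q⇒0≤q-p W≤RU))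
              (0≤* (0≤* (ℚ.<⇒≤ 0<q+1) 0≤R) (p≤q⇒0≤q-p qu≤2d))) (0≤* (ℚ.<⇒≤ 0<q) (ℚ.<⇒≤ 0<D)))
        (solve 5 (λ q u v R d → (q :* (q :+ con 1ℚ) :* v :+ d) :+
            (((q :* (q :+ con 1ℚ)) :* (R :* u :- v) :+ ((q :+ con 1ℚ) :* R) :* ((d :+ d) :- q :* u)) :+ q :* d)
          := (R :+ R :+ con 1ℚ) :* ((q :+ con 1ℚ) :* d)) refl q u v R d)

-- A root ρ of D r m with D ρ k > 0 for k < m, obtained by bisecting on "D q k > 0 for all k ≤ m".
module Root (m : ℕ) where

  private
    H = proj₁ (large (suc m))
    large-at-H = proj₂ (proj₂ (proj₂ (large (suc m)))) H ℚ.≤-refl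

  open Bisection (Supercritical (suc m)) (supercritical? (suc m)) 1ℚ H
    (proj₁ large-at-H) (supercritical-1 m) (proj₂ (proj₂ (proj₂ large-at-H)))
    using (lower; upper; lower≈upper; ¬A-lower; A-upper; l₀≤lower)

  opaque

    ρ ρ⁺ : ℝ
    ρ  = lower
    ρ⁺ = upper

  opaque
    unfolding ⌜_⌝ ρ

    1≼ρ : 1# ≼ ρ
    1≼ρ = pointwise-≼ l₀≤lower

    ρ≈ρ⁺ : ρ ≈ ρ⁺
    ρ≈ρ⁺ = lower≈upper

    -- The approximants of `ρ⁺` are the upper ends, all supercritical, and strict inequalities pass
    -- to the limit as weak ones.
    0≼D-upper : ∀ k → k ℕ.≤ m → 0# ≼ D ρ⁺ k
    0≼D-upper k k≤m = pointwise-≼ λ n → subst (0ℚ ℚ.≤_) (sym (seq-D ρ⁺ k n))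
      (ℚ.<⇒≤ (positive (A-upper n) (ℕ.≤⇒≤′ (s≤s k≤m))))
      where
      positive : ∀ {m k q} → Supercritical m q → suc k ℕ.≤′ m → 0ℚ ℚ.< Dℚ q k
      positive {suc m} (_ , 0<D) ℕ.≤′-refl = 0<D
      positive {suc m} (s , _) (ℕ.≤′-step h) = positive s h

    eventually-supercritical : ∀ m → (∀ k → k ℕ.< m → 0# ≺ D ρ k) →
      DoubleNegation (Eventually λ n → Supercritical m (seq ρ n))
    eventually-supercritical zero    h ¬ev = ¬ev (0 , λ _ _ → tt)
    eventually-supercritical (suc m) h ¬ev =
      eventually-supercritical m (λ k k<m → h k (ℕ.m<n⇒m<1+n k<m)) λ ev →
      ≺⇒¬¬≪ (h m (ℕ.n<1+n m)) λ (δ , 0<δ , ev′) →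
      ¬ev (eventually₂ (λ n s δ≤D → s , subst (0ℚ ℚ.<_) (seq-D ρ m n)
        (ℚ.<-≤-trans (subst (0ℚ ℚ.<_) (sym (ℚ.+-identityˡ δ)) 0<δ) δ≤D)) ev ev′)

    -- Positivity is an open condition: if all defects were positive at `ρ`, its approximants from
    -- below would eventually be supercritical, against the choice of the lower ends.
    ¬supercritical : ¬ (∀ k → k ℕ.< suc m → 0# ≺ D ρ k)
    ¬supercritical h = eventually-supercritical (suc m) h λ (N , s) → ¬A-lower N (s N ℕ.≤-refl)

  0≼D : ∀ k → k ℕ.≤ m → 0# ≼ D ρ k
  0≼D k k≤m = ≼-trans (0≼D-upper k k≤m) (≈⇒≽ (D-cong ρ≈ρ⁺ k))

  0≺ρ : 0# ≺ ρ
  0≺ρ = ≺-≼-trans 0≺1 1≼ρ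

  0≺ρ+1 : 0# ≺ ρ + 1#
  0≺ρ+1 = 0≺x+y 0≺ρ (≺⇒≼ 0≺1)

  c : ℝ
  c = ρ · (ρ + 1#)

  0≺c : 0# ≺ c
  0≺c = 0≺x·y 0≺ρ 0≺ρ+1

  0≺W : ∀ k → k ℕ.≤ suc m → 0# ≺ W ρ k
  0≺W zero    _         = 0≺1
  0≺W (suc k) (s≤s k≤m) = 0≺x+y (0≺x·y 0≺c (0≺W k (ℕ.m≤n⇒m≤1+n k≤m))) (0≼D k k≤m)

  -- A vanishing defect makes the next U vanish, so the next defect is minus the next W, which is
  -- negative and contradicts `0≼D`.
  0≺D : ∀ k → k ℕ.< m → 0# ≺ D ρ k
  0≺D k k<m D≼0 = 0≺D-next (0≼D (suc k) k<m)
    where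
    open ≈-Solver
    0≺D-next : D ρ (suc k) ≺ 0#
    0≺D-next = ≺-by (W ρ (suc k)) (0≺W (suc k) (s≤s (ℕ.<⇒≤ k<m))) (≈-trans
      (solve 3 (λ r d w → (r :* ((r :+ con 1ℚ) :* d) :- w) :+ w := (r :* (r :+ con 1ℚ)) :* d)
        ≈-refl ρ (D ρ k) (W ρ (suc k)))
      (y≈0⇒x·y≈0 c (≼-antisym D≼0 (0≼D k (ℕ.<⇒≤ k<m)))))

  D≈0 : D ρ m ≈ 0#
  D≈0 = ≼-antisym (≼-stable λ 0≺Dm → ¬supercritical λ k k<1+m → positive k k<1+m 0≺Dm) (0≼D m ℕ.≤-refl)
    where
    positive : ∀ k → k ℕ.< suc m → 0# ≺ D ρ m → 0# ≺ D ρ k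
    positive k (s≤s k≤m) 0≺Dm with k ℕ.≟ m
    ... | yes refl = 0≺Dm
    ... | no k≢m   = 0≺D k (ℕ.≤∧≢⇒< k≤m k≢m)

  0≺U : ∀ k → k ℕ.≤ m → 0# ≺ U ρ k
  0≺U zero    _   = 0≺1
  0≺U (suc k) k<m = 0≺x·y 0≺ρ+1 (0≺D k k<m)

ι : Bool → ℝ
ι b = if b then 1# else 0#

0≼ι : ∀ b → 0# ≼ ι b
0≼ι true  = ≺⇒≼ 0≺1
0≼ι false = ≼-refl

sum-0· : ∀ {n} (f : Fin n → ℝ) → sum (λ i → 0# · f i) ≈ 0#
sum-0· f = ≈-trans (≈-sym (·-sum 0# f)) (x≈0⇒x·y≈0 (sum f) ≈-refl)

sum-1· : ∀ {n} (f : Fin n → ℝ) → sum (λ i → 1# · f i) ≈ sum f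
sum-1· f = sum-cong λ i → ·-identityˡ (f i)

sum-scaled : ∀ {n} c (a f : Fin n → ℝ) → sum (λ i → a i · (c · f i)) ≈ c · sum (λ i → a i · f i)
sum-scaled c a f = ≈-trans
  (sum-cong λ i → solve 3 (λ c a f → a :* (c :* f) := c :* (a :* f)) ≈-refl c (a i) (f i))
  (≈-sym (·-sum c _))
  where open ≈-Solver

le ne : ∀ {n} → Fin n → Fin n → ℝ
le i j = ι (does (i Fin.≤? j))
ne i j = ι (does (¬? (i Fin.≟ j)))

le-suc : ∀ {n} (i j : Fin n) → le (suc i) (suc j) ≡ le i j
le-suc zero    j = refl
le-suc (suc i) j = refl

-- The eigenvalue equations of G(2n,1) up to a common defect

module EigenVector (r : ℝ) where

  open ≈-Solver
  open import Relation.Binary.Reasoning.Setoid (CommutativeRing.setoid ℝ-commutativeRing)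

  c : ℝ
  c = r · (r + 1#)

  -- Index 0 is the newest pair and each new pair scales the older ones by `c`, so `u k i` is cⁱ
  -- times U at k - i and no division occurs.
  u w : ∀ k → Fin (suc k) → ℝ
  u k       zero    = U r k
  u (suc k) (suc i) = c · u k i
  w k       zero    = W r k
  w (suc k) (suc i) = c · w k i

  -- For any `r`, every equation of both kinds fails by the same amount `D r k`; hence a root of
  -- this single polynomial satisfies them all.
  equation-u : ∀ k i → sum (λ j → le j i · w k j) + D r k ≈ r · u k i
  equation-u zero zero = begin
    sum {1} (λ j → le j zero · w zero j) + D r zero ≈⟨ +-cong (≈-trans (sum-suc _) (+-cong ≈-refl (sum-zero _))) ≈-refl ⟩
    (1# · 1# + 0#) + (r · 1# - 1#)
      ≈⟨ solve 1 (λ r → (con 1ℚ :* con 1ℚ :+ con 0ℚ) :+ (r :* con 1ℚ :- con 1ℚ) := r :* con 1ℚ) ≈-refl r ⟩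
    r · 1# ∎
  equation-u (suc k) zero = begin
    sum (λ j → le j zero · w (suc k) j) + D r (suc k)
      ≈⟨ +-cong (≈-trans (sum-suc _) (+-cong ≈-refl (sum-0· _))) ≈-refl ⟩
    (1# · W r (suc k) + 0#) + (r · U r (suc k) - W r (suc k))
      ≈⟨ solve 3 (λ r u w → (con 1ℚ :* w :+ con 0ℚ) :+ (r :* u :- w) := r :* u) ≈-refl r (U r (suc k)) (W r (suc k)) ⟩
    r · U r (suc k) ∎
  equation-u (suc k) (suc i) = begin
    sum (λ j → le j (suc i) · w (suc k) j) + D r (suc k)
      ≈⟨ +-cong (≈-trans (sum-suc _) (+-cong ≈-refl (≈-trans
           (sum-cong λ j → ·-congʳ _ (≡⇒≈ (le-suc j i))) (sum-scaled c _ (w k))))) ≈-refl ⟩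
    (1# · W r (suc k) + c · S) + D r (suc k)
      ≈⟨ solve 4 (λ r d w s → let c = r :* (r :+ con 1ℚ) in
           (con 1ℚ :* w :+ c :* s) :+ (r :* ((r :+ con 1ℚ) :* d) :- w) := c :* (s :+ d))
           ≈-refl r (D r k) (W r (suc k)) S ⟩
    c · (S + D r k)       ≈⟨ ·-congˡ c (equation-u k i) ⟩
    c · (r · u k i)       ≈⟨ solve 3 (λ c r u → c :* (r :* u) := r :* (c :* u)) ≈-refl c r (u k i) ⟩
    r · (c · u k i)       ∎
    where S = sum (λ j → le j i · w k j)

  equation-w : ∀ k i → (sum (λ j → le i j · u k j) + sum (λ j → ne i j · w k j)) + D r k ≈ r · w k i
  -- The first w is adjacent to every other vertex, so its equation with its own coordinate added
  -- evaluates the sum of all coordinates. The equation of the next first w needs this sum.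
  total : ∀ k → (sum (u k) + sum (w k)) + D r k ≈ r · W r k + W r k

  equation-w zero zero = begin
    (sum {1} (λ j → le zero j · u zero j) + sum {1} (λ j → ne zero j · w zero j)) + D r zero
      ≈⟨ +-cong (+-cong (≈-trans (sum-suc _) (+-cong ≈-refl (sum-zero _)))
                        (≈-trans (sum-suc _) (+-cong ≈-refl (sum-zero _)))) ≈-refl ⟩
    ((1# · 1# + 0#) + (0# · 1# + 0#)) + (r · 1# - 1#)
      ≈⟨ solve 1 (λ r → ((con 1ℚ :* con 1ℚ :+ con 0ℚ) :+ (con 0ℚ :* con 1ℚ :+ con 0ℚ)) :+ (r :* con 1ℚ :- con 1ℚ)
           := r :* con 1ℚ) ≈-refl r ⟩
    r · 1# ∎
  equation-w (suc k) zero = begin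
    (sum (λ j → le zero j · u (suc k) j) + sum (λ j → ne zero j · w (suc k) j)) + D r (suc k)
      ≈⟨ +-cong (+-cong
           (≈-trans (sum-suc _) (+-cong ≈-refl (≈-trans (sum-1· _) (≈-sym (·-sum c (u k))))))
           (≈-trans (sum-suc _) (+-cong ≈-refl (≈-trans (sum-1· _) (≈-sym (·-sum c (w k)))))))
           ≈-refl ⟩
    ((1# · U r (suc k) + c · Σu) + (0# · W r (suc k) + c · Σw)) + D r (suc k)
      ≈⟨ solve 6 (λ r d w x y w′ → let c = r :* (r :+ con 1ℚ) ; u′ = (r :+ con 1ℚ) :* d in
           ((con 1ℚ :* u′ :+ c :* x) :+ (con 0ℚ :* w′ :+ c :* y)) :+ (r :* u′ :- w′)
           := c :* ((x :+ y) :+ d) :+ (((r :+ con 1ℚ) :* d) :- w′)) ≈-refl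
           r (D r k) (W r k) Σu Σw (W r (suc k)) ⟩
    c · ((Σu + Σw) + D r k) + ((r + 1#) · D r k - W r (suc k))
      ≈⟨ +-cong (·-congˡ c (total k)) ≈-refl ⟩
    c · (r · W r k + W r k) + ((r + 1#) · D r k - W r (suc k))
      ≈⟨ solve 3 (λ r d w → let c = r :* (r :+ con 1ℚ) ; w′ = c :* w :+ d in
           c :* (r :* w :+ w) :+ ((r :+ con 1ℚ) :* d :- w′) := r :* w′) ≈-refl r (D r k) (W r k) ⟩
    r · W r (suc k) ∎
    where
    Σu = sum (u k)
    Σw = sum (w k)
  equation-w (suc k) (suc i) = begin
    (sum (λ j → le (suc i) j · u (suc k) j) + sum (λ j → ne (suc i) j · w (suc k) j)) + D r (suc k)
      ≈⟨ +-cong (+-cong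
           (≈-trans (sum-suc _) (+-cong ≈-refl (≈-trans
             (sum-cong λ j → ·-congʳ _ (≡⇒≈ (le-suc i j))) (sum-scaled c _ (u k)))))
           (≈-trans (sum-suc _) (+-cong ≈-refl (sum-scaled c _ (w k)))))
           ≈-refl ⟩
    ((0# · U r (suc k) + c · A) + (1# · W r (suc k) + c · B)) + D r (suc k)
      ≈⟨ solve 5 (λ r d w′ a b → let c = r :* (r :+ con 1ℚ) ; u′ = (r :+ con 1ℚ) :* d in
           ((con 0ℚ :* u′ :+ c :* a) :+ (con 1ℚ :* w′ :+ c :* b)) :+ (r :* u′ :- w′)
           := c :* ((a :+ b) :+ d)) ≈-refl r (D r k) (W r (suc k)) A B ⟩
    c · ((A + B) + D r k) ≈⟨ ·-congˡ c (equation-w k i) ⟩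
    c · (r · w k i)       ≈⟨ solve 3 (λ c r u → c :* (r :* u) := r :* (c :* u)) ≈-refl c r (w k i) ⟩
    r · (c · w k i)       ∎
    where
    A = sum (λ j → le i j · u k j)
    B = sum (λ j → ne i j · w k j)

  total k = begin
    (sum (u k) + sum (w k)) + D r k
      ≈⟨ +-cong (+-cong (≈-sym (sum-1· _)) (≈-trans (sum-suc _) (+-cong ≈-refl (≈-sym (sum-1· _))))) ≈-refl ⟩
    (sum (λ j → 1# · u k j) + (W r k + B)) + D r k
      ≈⟨ solve 4 (λ a b d w → (a :+ (w :+ b)) :+ d := ((a :+ (con 0ℚ :* w :+ b)) :+ d) :+ w) ≈-refl
           (sum (λ j → 1# · u k j)) B (D r k) (W r k) ⟩
    ((sum (λ j → 1# · u k j) + (0# · W r k + B)) + D r k) + W r k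
      ≈⟨ +-cong (+-cong (+-cong ≈-refl (sum-suc _)) ≈-refl) ≈-refl ⟨
    ((sum (λ j → le zero j · u k j) + sum (λ j → ne zero j · w k j)) + D r k) + W r k
      ≈⟨ +-cong (equation-w k zero) ≈-refl ⟩
    r · W r k + W r k ∎
    where B = sum (λ j → 1# · w k (suc j))

-- Positivity and monotonicity of the Perron vector

module Perron (m : ℕ) where

  open Root m public using (ρ)
  open Root m hiding (ρ)
  open EigenVector ρ hiding (c)
  open ≈-Solver

  -- The gap is (ρ + 1) W. After scaling by powers of `c`, this says that u increases along the
  -- numbering, and `cW≼W` that w does not increase.
  U≺cU : ∀ k → k ℕ.≤ m → U ρ (suc k) ≺ c · U ρ k
  U≺cU k k≤m = ≺-by _ (0≺x·y 0≺ρ+1 (0≺W k (ℕ.m≤n⇒m≤1+n k≤m)))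
    (solve 3 (λ r u w → (r :+ con 1ℚ) :* (r :* u :- w) :+ (r :+ con 1ℚ) :* w := (r :* (r :+ con 1ℚ)) :* u)
      ≈-refl ρ (U ρ k) (W ρ k))

  cW≼W : ∀ k → k ℕ.≤ m → c · W ρ k ≼ W ρ (suc k)
  cW≼W k k≤m = ≼-by _ (0≼D k k≤m) ≈-refl

  U≺W : ∀ k → suc k ℕ.≤ m → U ρ (suc k) ≺ W ρ (suc k)
  U≼W : ∀ k → k ℕ.≤ m → U ρ k ≼ W ρ k
  U≺W k k<m = ≺-≼-trans (U≺cU k (ℕ.<⇒≤ k<m)) (≼-trans (·-monoˡ-≼ (≺⇒≼ 0≺c) (U≼W k (ℕ.<⇒≤ k<m)))
    (cW≼W k (ℕ.<⇒≤ k<m)))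
  U≼W zero    _   = ≼-refl
  U≼W (suc k) k<m = ≺⇒≼ (U≺W k k<m)

  0≺u : ∀ k → k ℕ.≤ m → ∀ i → 0# ≺ u k i
  0≺u k       k≤m zero    = 0≺U k k≤m
  0≺u (suc k) k<m (suc i) = 0≺x·y 0≺c (0≺u k (ℕ.<⇒≤ k<m) i)

  0≺w : ∀ k → k ℕ.≤ m → ∀ i → 0# ≺ w k i
  0≺w k       k≤m zero    = 0≺W k (ℕ.m≤n⇒m≤1+n k≤m)
  0≺w (suc k) k<m (suc i) = 0≺x·y 0≺c (0≺w k (ℕ.<⇒≤ k<m) i)

  u≼w : ∀ k → k ℕ.≤ m → ∀ i → u k i ≼ w k i
  u≼w k       k≤m zero    = U≼W k k≤m
  u≼w (suc k) k<m (suc i) = ·-monoˡ-≼ (≺⇒≼ 0≺c) (u≼w k (ℕ.<⇒≤ k<m) i)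

  U≼u : ∀ k → k ℕ.≤ m → ∀ i → U ρ k ≼ u k i
  U≼u k       k≤m zero    = ≼-refl
  U≼u (suc k) k<m (suc i) = ≼-trans (≺⇒≼ (U≺cU k (ℕ.<⇒≤ k<m))) (·-monoˡ-≼ (≺⇒≼ 0≺c) (U≼u k (ℕ.<⇒≤ k<m) i))

  w≼W : ∀ k → k ℕ.≤ m → ∀ i → w k i ≼ W ρ k
  w≼W k       k≤m zero    = ≼-refl
  w≼W (suc k) k<m (suc i) = ≼-trans (·-monoˡ-≼ (≺⇒≼ 0≺c) (w≼W k (ℕ.<⇒≤ k<m) i)) (cW≼W k (ℕ.<⇒≤ k<m))

  scaled : ∀ {x y x′ y′} → x · y ≺ x′ · y′ → (c · x) · (c · y) ≺ (c · x′) · (c · y′)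
  scaled {x} {y} {x′} {y′} h = ≼-≺-trans (≈⇒≼ (rearrange x y))
    (≺-≼-trans (·-monoˡ-≺ (0≺x·y 0≺c 0≺c) h) (≈⇒≽ (rearrange x′ y′)))
    where
    rearrange : ∀ x y → (c · x) · (c · y) ≈ (c · c) · (x · y)
    rearrange = solve 3 (λ c x y → (c :* x) :* (c :* y) := (c :* c) :* (x :* y)) ≈-refl c

  -- Strictness comes from `i`: as i < j, the pair `i` is not the last one, which alone has equal
  -- coordinates.
  uu≺ww : ∀ k → k ℕ.≤ m → ∀ i j → i Fin.< j → u k i · u k j ≺ w k i · w k j
  uu≺ww (suc k) k<m zero (suc j) _ = ≼-≺-trans (≈⇒≼ (·-comm _ _)) (≺-≼-trans
    (·-monoˡ-≺ (0≺x·y 0≺c (0≺u k (ℕ.<⇒≤ k<m) j)) (U≺W k k<m))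
    (≼-trans (≈⇒≼ (·-comm _ _)) (·-monoˡ-≼ (≺⇒≼ (0≺w (suc k) k<m zero)) (u≼w (suc k) k<m (suc j)))))
  uu≺ww (suc k) k<m (suc i) (suc j) (s≤s i<j) = scaled (uu≺ww k (ℕ.<⇒≤ k<m) i j i<j)

  -- u i is replaced by the strictly larger u j, then w j by w i, which is at least as large.
  uw≺wu : ∀ k → k ℕ.≤ m → ∀ i j → i Fin.< j → u k i · w k j ≺ w k i · u k j
  uw≺wu (suc k) k<m zero (suc j) _ = ≼-≺-trans (≈⇒≼ (·-comm _ _)) (≺-≼-trans
    (·-monoˡ-≺ (0≺w (suc k) k<m (suc j)) (≺-≼-trans (U≺cU k (ℕ.<⇒≤ k<m))
      (·-monoˡ-≼ (≺⇒≼ 0≺c) (U≼u k (ℕ.<⇒≤ k<m) j))))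
    (·-monoʳ-≼ (≺⇒≼ (0≺u (suc k) k<m (suc j))) (w≼W (suc k) k<m (suc j))))
  uw≺wu (suc k) k<m (suc i) (suc j) (s≤s i<j) = scaled (uw≺wu k (ℕ.<⇒≤ k<m) i j i<j)

  private
    drop-D : ∀ {x y} → x + D ρ m ≈ y → x ≈ y
    drop-D {x} h = ≈-trans (≈-trans (solve 1 (λ x → x := x :+ con 0ℚ) ≈-refl x) (+-cong ≈-refl (≈-sym D≈0))) h

  v : Fin (suc m) ⊎ Fin (suc m) → ℝ
  v (inj₁ i) = u m i
  v (inj₂ i) = w m i

  0≺v : ∀ s → 0# ≺ v s
  0≺v (inj₁ i) = 0≺u m ℕ.≤-refl i
  0≺v (inj₂ i) = 0≺w m ℕ.≤-refl i

  eigen-u : ∀ i → sum (λ j → le j i · v (inj₂ j)) ≈ ρ · v (inj₁ i)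
  eigen-u i = drop-D (equation-u m i)

  eigen-w : ∀ i → sum (λ j → le i j · v (inj₁ j)) + sum (λ j → ne i j · v (inj₂ j)) ≈ ρ · v (inj₂ i)
  eigen-w i = drop-D (equation-w m i)

  v-uu≺ww : ∀ i j → i Fin.< j → v (inj₁ i) · v (inj₁ j) ≺ v (inj₂ i) · v (inj₂ j)
  v-uu≺ww = uu≺ww m ℕ.≤-refl

  v-uw≺wu : ∀ i j → i Fin.< j → v (inj₁ i) · v (inj₂ j) ≺ v (inj₂ i) · v (inj₁ j)
  v-uw≺wu = uw≺wu m ℕ.≤-refl

-- Comparison of quadratic forms

sum-⊎ : ∀ {m n} → (Fin m ⊎ Fin n → ℝ) → ℝ
sum-⊎ f = sum (f ∘ inj₁) + sum (f ∘ inj₂)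

sum-⊎-cong : ∀ {m n} {f g : Fin m ⊎ Fin n → ℝ} → (∀ s → f s ≈ g s) → sum-⊎ f ≈ sum-⊎ g
sum-⊎-cong h = +-cong (sum-cong (h ∘ inj₁)) (sum-cong (h ∘ inj₂))

sum-⊎-mono : ∀ {m n} {f g : Fin m ⊎ Fin n → ℝ} → (∀ s → f s ≼ g s) → sum-⊎ f ≼ sum-⊎ g
sum-⊎-mono h = +-mono-≼ (sum-mono-≼ (h ∘ inj₁)) (sum-mono-≼ (h ∘ inj₂))

·-sum-⊎ : ∀ {m n} x (f : Fin m ⊎ Fin n → ℝ) → x · sum-⊎ f ≈ sum-⊎ (λ s → x · f s)
·-sum-⊎ x f = ≈-trans (·-distribˡ-+ x _ _) (+-cong (·-sum x _) (·-sum x _))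

sum-splitAt : ∀ m {n} (f : Fin m ⊎ Fin n → ℝ) → sum (f ∘ Fin.splitAt m) ≈ sum-⊎ f
sum-splitAt zero f = ≈-trans (≈-sym (+-identityˡ _)) (+-cong (≈-sym (sum-zero _)) ≈-refl)
sum-splitAt (suc m) f = ≈-trans (sum-suc _) (≈-trans (+-cong ≈-refl (sum-splitAt m (f ∘ Sum.map suc id)))
  (≈-trans (≈-sym (+-assoc _ _ _)) (+-cong (≈-sym (sum-suc _)) ≈-refl)))

norm²-⊎ : ∀ {m n} → (Fin m ⊎ Fin n → ℝ) → ℝ
norm²-⊎ y = sum-⊎ λ s → y s · y s

quadratic-⊎ : ∀ {m n} → (Fin m ⊎ Fin n → Fin m ⊎ Fin n → Bool) → (Fin m ⊎ Fin n → ℝ) → ℝ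
quadratic-⊎ b y = sum-⊎ λ s → sum-⊎ λ t → ι (b s t) · (y s · y t)

norm²-⊎-splitAt : ∀ m {n} (y : Fin m ⊎ Fin n → ℝ) → norm² (y ∘ Fin.splitAt m) ≈ norm²-⊎ y
norm²-⊎-splitAt m y = sum-splitAt m (λ s → y s · y s)

quadratic-⊎-splitAt : ∀ m {n} (b : Fin m ⊎ Fin n → Fin m ⊎ Fin n → Bool) y →
  quadratic (λ i j → ι (b (Fin.splitAt m i) (Fin.splitAt m j))) (y ∘ Fin.splitAt m) ≈ quadratic-⊎ b y
quadratic-⊎-splitAt m b y = ≈-trans
  (sum-cong λ i → sum-splitAt m (λ t → ι (b (Fin.splitAt m i) t) · (y (Fin.splitAt m i) · y t)))
  (sum-splitAt m (λ s → sum-⊎ λ t → ι (b s t) · (y s · y t)))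

module _ {n : ℕ} (b : Fin n ⊎ Fin n → Fin n ⊎ Fin n → Bool) (y : Fin n ⊎ Fin n → ℝ) where

  private
    term : Fin n ⊎ Fin n → Fin n ⊎ Fin n → ℝ
    term s t = ι (b s t) · (y s · y t)

  -- An alternating 4-cycle lives on two matching edges, so the entries joining the edges `i` and
  -- `j` are the units in which the forms can be compared.
  block : Fin n → Fin n → ℝ
  block i j = (term (inj₁ i) (inj₁ j) + term (inj₁ i) (inj₂ j))
            + (term (inj₂ i) (inj₁ j) + term (inj₂ i) (inj₂ j))

  quadratic-block : quadratic-⊎ b y ≈ sum λ i → sum λ j → block i j
  quadratic-block = ≈-trans (≈-sym (sum-+ _ _)) (sum-cong λ i →
    ≈-trans (+-cong (≈-sym (sum-+ _ _)) (≈-sym (sum-+ _ _))) (≈-sym (sum-+ _ _)))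

ι-pair : ∀ b b′ {p q} → 0# ≼ p → p ≼ q → ¬ (b ≡ true × b′ ≡ true) → ι b · p + ι b′ · q ≼ q
ι-pair true  true  0≼p p≼q h = contradiction (refl , refl) h
ι-pair true  false {p} {q} 0≼p p≼q h = ≼-trans (≈⇒≼
  (solve 2 (λ p q → con 1ℚ :* p :+ con 0ℚ :* q := p) ≈-refl p q)) p≼q
  where open ≈-Solver
ι-pair false true  {p} {q} 0≼p p≼q h = ≈⇒≼
  (solve 2 (λ p q → con 0ℚ :* p :+ con 1ℚ :* q := q) ≈-refl p q)
  where open ≈-Solver
ι-pair false false {p} {q} 0≼p p≼q h = ≼-trans (≈⇒≼
  (solve 2 (λ p q → con 0ℚ :* p :+ con 0ℚ :* q := con 0ℚ) ≈-refl p q)) (≼-trans 0≼p p≼q)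
  where open ≈-Solver

-- Strictness is essential: for p = q the lighter edge alone would also attain the bound.
ι-pair-tight : ∀ b b′ {p q} → 0# ≼ p → p ≺ q → ¬ (b ≡ true × b′ ≡ true) →
  q ≼ ι b · p + ι b′ · q → b ≡ false × b′ ≡ true
ι-pair-tight true  true  0≼p p≺q h k = contradiction (refl , refl) h
ι-pair-tight true  false {p} {q} 0≼p p≺q h k = contradiction (≼-trans k (≈⇒≼
  (solve 2 (λ p q → con 1ℚ :* p :+ con 0ℚ :* q := p) ≈-refl p q))) p≺q
  where open ≈-Solver
ι-pair-tight false true  0≼p p≺q h k = refl , refl
ι-pair-tight false false {p} {q} 0≼p p≺q h k = contradiction (≼-trans k (≼-trans (≈⇒≼
  (solve 2 (λ p q → con 0ℚ :* p :+ con 0ℚ :* q := con 0ℚ) ≈-refl p q)) 0≼p)) p≺q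
  where open ≈-Solver

adj : ∀ {n} → Fin n ⊎ Fin n → Fin n ⊎ Fin n → Bool
adj {n} s t = does (Defs.Adj? n s t)

adj-sym : ∀ {n} (s t : Fin n ⊎ Fin n) → adj s t ≡ adj t s
adj-sym (inj₁ i) (inj₁ j) = refl
adj-sym (inj₁ i) (inj₂ j) = refl
adj-sym (inj₂ i) (inj₁ j) = refl
adj-sym (inj₂ i) (inj₂ j) with i Fin.≟ j | j Fin.≟ i
... | yes _   | yes _   = refl
... | yes i≡j | no j≢i  = contradiction (sym i≡j) j≢i
... | no i≢j  | yes j≡i = contradiction (sym j≡i) i≢j
... | no _    | no _    = refl

-- The two potential pairs of edges between the matching edges {u i, w i} and {u j, w j}
-- exclude each other, so at most the heavier edge of each pair contributes.
module Comparison {n : ℕ} (b : Fin n ⊎ Fin n → Fin n ⊎ Fin n → Bool)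
  (b-sym : ∀ s t → b s t ≡ b t s)
  (b-irrefl : ∀ s → b s s ≡ false)
  (b-matched : ∀ i → b (inj₁ i) (inj₂ i) ≡ true)
  (parallel : ∀ i j → i ≢ j → ¬ (b (inj₁ i) (inj₁ j) ≡ true × b (inj₂ i) (inj₂ j) ≡ true))
  (crossing : ∀ i j → i ≢ j → ¬ (b (inj₁ i) (inj₂ j) ≡ true × b (inj₂ i) (inj₁ j) ≡ true))
  (y : Fin n ⊎ Fin n → ℝ)
  (0≼y : ∀ s → 0# ≼ y s)
  (oriented : ∀ i → y (inj₁ i) ≼ y (inj₂ i))
  (sorted : ∀ i j → i Fin.≤ j → y (inj₁ i) · y (inj₂ j) ≼ y (inj₂ i) · y (inj₁ j)) where

  open ≈-Solver

  private
    u w : Fin n → ℝ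
    u i = y (inj₁ i)
    w i = y (inj₂ i)

    yes-≤ : ∀ {i j : Fin n} → i Fin.≤ j → does (i Fin.≤? j) ≡ true
    yes-≤ {i} {j} = dec-true (i Fin.≤? j)

    no-≤ : ∀ {i j : Fin n} → ¬ (i Fin.≤ j) → does (i Fin.≤? j) ≡ false
    no-≤ {i} {j} = dec-false (i Fin.≤? j)

    yes-≢ : ∀ {i j : Fin n} → i ≢ j → does (¬? (i Fin.≟ j)) ≡ true
    yes-≢ {i} {j} = dec-true (¬? (i Fin.≟ j))

  uu≼ww : ∀ i j → u i · u j ≼ w i · w j
  uu≼ww i j = ≼-trans (·-monoˡ-≼ (0≼y _) (oriented j)) (·-monoʳ-≼ (0≼y _) (oriented i))

  block-< : ∀ b′ i j → block b′ y i j ≈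
    (ι (b′ (inj₁ i) (inj₂ j)) · (u i · w j) + ι (b′ (inj₂ i) (inj₁ j)) · (w i · u j))
    + (ι (b′ (inj₁ i) (inj₁ j)) · (u i · u j) + ι (b′ (inj₂ i) (inj₂ j)) · (w i · w j))
  block-< b′ i j = solve 4 (λ a b c d → (a :+ b) :+ (c :+ d) := (b :+ c) :+ (a :+ d)) ≈-refl _ _ _ _

  block-sym : ∀ b′ → (∀ s t → b′ s t ≡ b′ t s) → ∀ i j → block b′ y i j ≈ block b′ y j i
  block-sym b′ sym i j = ≈-trans
    (+-cong (+-cong (term _ _) (term _ _)) (+-cong (term _ _) (term _ _)))
    (solve 4 (λ a b c d → (a :+ b) :+ (c :+ d) := (a :+ c) :+ (b :+ d)) ≈-refl _ _ _ _)
    where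
    term : ∀ s t → ι (b′ s t) · (y s · y t) ≈ ι (b′ t s) · (y t · y s)
    term s t = ·-cong (≡⇒≈ (cong ι (sym s t))) (·-comm _ _)

  adj-block-< : ∀ {i j} → i Fin.< j → block adj y i j ≈ w i · u j + w i · w j
  adj-block-< {i} {j} i<j = ≈-trans (block-< adj i j) (≈-trans
    (+-cong (+-cong (·-congʳ _ (≡⇒≈ (cong ι (no-≤ (ℕ.<⇒≱ i<j)))))
                    (·-congʳ _ (≡⇒≈ (cong ι (yes-≤ (ℕ.<⇒≤ i<j))))))
            (+-cong ≈-refl (·-congʳ _ (≡⇒≈ (cong ι (yes-≢ (Fin.<⇒≢ i<j)))))))
    (solve 4 (λ a b c d → (con 0ℚ :* a :+ con 1ℚ :* b) :+ (con 0ℚ :* c :+ con 1ℚ :* d) := b :+ d) ≈-refl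
      (u i · w j) (w i · u j) (u i · u j) (w i · w j)))

  block-≼-< : ∀ i j → i Fin.< j → block b y i j ≼ block adj y i j
  block-≼-< i j i<j = ≼-trans (≈⇒≼ (block-< b i j)) (≼-trans
    (+-mono-≼
      (ι-pair (b (inj₁ i) (inj₂ j)) _ (0≼x·y (0≼y _) (0≼y _)) (sorted i j (ℕ.<⇒≤ i<j)) (crossing i j (Fin.<⇒≢ i<j)))
      (ι-pair (b (inj₁ i) (inj₁ j)) _ (0≼x·y (0≼y _) (0≼y _)) (uu≼ww i j) (parallel i j (Fin.<⇒≢ i<j))))
    (≈⇒≽ (adj-block-< i<j)))

  -- Irreflexivity leaves only the matching edge in a diagonal block, and this edge is present in
  -- both graphs.
  b-diagonal : ∀ i → block b y i i ≈ block adj y i i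
  b-diagonal i = +-cong
    (+-cong (·-congʳ _ (≡⇒≈ (cong ι (b-irrefl _))))
            (·-congʳ _ (≡⇒≈ (cong ι (trans (b-matched i) (sym (yes-≤ (ℕ.≤-refl {Fin.toℕ i}))))))))
    (+-cong (·-congʳ _ (≡⇒≈ (cong ι (trans (b-sym _ _) (trans (b-matched i) (sym (yes-≤ (ℕ.≤-refl {Fin.toℕ i}))))))))
            (·-congʳ _ (≡⇒≈ (cong ι (trans (b-irrefl _) (sym (dec-false (¬? (i Fin.≟ i)) λ i≢i → i≢i refl)))))))

  block-≼ : ∀ i j → block b y i j ≼ block adj y i j
  block-≼ i j with Fin.<-cmp i j
  ... | tri< i<j _ _ = block-≼-< i j i<j
  ... | tri≈ _ refl _ = ≈⇒≼ (b-diagonal i)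
  ... | tri> _ _ j<i = ≼-trans (≈⇒≼ (block-sym b b-sym i j))
    (≼-trans (block-≼-< j i j<i) (≈⇒≼ (block-sym adj adj-sym j i)))

  quadratic-≼ : quadratic-⊎ b y ≼ quadratic-⊎ adj y
  quadratic-≼ = ≼-trans (≈⇒≼ (quadratic-block b y))
    (≼-trans (sum-mono-≼ λ i → sum-mono-≼ (block-≼ i)) (≈⇒≽ (quadratic-block adj y)))

  module Tight
    (uu≺ww : ∀ i j → i Fin.< j → u i · u j ≺ w i · w j)
    (uw≺wu : ∀ i j → i Fin.< j → u i · w j ≺ w i · u j)
    (tight : quadratic-⊎ adj y ≼ quadratic-⊎ b y) where

    block-≽ : ∀ i j → block adj y i j ≼ block b y i j
    block-≽ i j = sum-mono-≼-tight (block-≼ i)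
      (sum-mono-≼-tight (λ i → sum-mono-≼ (block-≼ i))
        (≼-trans (≈⇒≽ (quadratic-block adj y)) (≼-trans tight (≈⇒≼ (quadratic-block b y)))) i) j

    -- Each exclusive pair contributes at most its heavier weight, and together they attain the sum
    -- of the two bounds; cancelling one bound shows that the other is attained.
    forced : ∀ i j → i Fin.< j →
      (b (inj₁ i) (inj₂ j) ≡ false × b (inj₂ i) (inj₁ j) ≡ true) ×
      (b (inj₁ i) (inj₁ j) ≡ false × b (inj₂ i) (inj₂ j) ≡ true)
    forced i j i<j =
        ι-pair-tight (b (inj₁ i) (inj₂ j)) _ (0≼x·y (0≼y _) (0≼y _)) (uw≺wu i j i<j) (crossing i j i≢j)
          (+-cancelʳ-≼ _ (≼-trans (+-monoʳ-≼ _ same) total))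
      , ι-pair-tight (b (inj₁ i) (inj₁ j)) _ (0≼x·y (0≼y _) (0≼y _)) (uu≺ww i j i<j) (parallel i j i≢j)
          (+-cancelʳ-≼ _ (≼-trans (≈⇒≼ (+-comm _ _)) (≼-trans (+-mono-≼ cross ≼-refl)
            (≼-trans total (≈⇒≼ (+-comm _ _))))))
      where
      i≢j : i ≢ j
      i≢j = Fin.<⇒≢ i<j
      total = ≼-trans (≈⇒≽ (adj-block-< i<j)) (≼-trans (block-≽ i j) (≈⇒≼ (block-< b i j)))
      cross : ι (b (inj₁ i) (inj₂ j)) · (u i · w j) + ι (b (inj₂ i) (inj₁ j)) · (w i · u j) ≼ w i · u j
      cross = ι-pair (b (inj₁ i) (inj₂ j)) _ (0≼x·y (0≼y _) (0≼y _)) (sorted i j (ℕ.<⇒≤ i<j)) (crossing i j i≢j)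
      same : ι (b (inj₁ i) (inj₁ j)) · (u i · u j) + ι (b (inj₂ i) (inj₂ j)) · (w i · w j) ≼ w i · w j
      same = ι-pair (b (inj₁ i) (inj₁ j)) _ (0≼x·y (0≼y _) (0≼y _)) (uu≼ww i j) (parallel i j i≢j)

    b≡adj : ∀ s t → b s t ≡ adj s t
    b≡adj (inj₁ i) (inj₁ j) with Fin.<-cmp i j
    ... | tri< i<j _ _  = proj₁ (proj₂ (forced i j i<j))
    ... | tri≈ _ refl _ = b-irrefl _
    ... | tri> _ _ j<i  = trans (b-sym _ _) (proj₁ (proj₂ (forced j i j<i)))
    b≡adj (inj₁ i) (inj₂ j) with Fin.<-cmp i j
    ... | tri< i<j _ _  = trans (proj₁ (proj₁ (forced i j i<j))) (sym (no-≤ (ℕ.<⇒≱ i<j)))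
    ... | tri≈ _ refl _ = trans (b-matched i) (sym (yes-≤ (ℕ.≤-refl {Fin.toℕ i})))
    ... | tri> _ _ j<i  = trans (b-sym _ _) (trans (proj₂ (proj₁ (forced j i j<i))) (sym (yes-≤ (ℕ.<⇒≤ j<i))))
    b≡adj (inj₂ i) (inj₁ j) = trans (b-sym _ _) (trans (b≡adj (inj₁ j) (inj₂ i)) (adj-sym (inj₁ j) (inj₂ i)))
    b≡adj (inj₂ i) (inj₂ j) with Fin.<-cmp i j
    ... | tri< i<j _ _  = trans (proj₂ (proj₂ (forced i j i<j))) (sym (yes-≢ (Fin.<⇒≢ i<j)))
    ... | tri≈ _ refl _ = trans (b-irrefl _) (sym (dec-false (¬? (i Fin.≟ i)) λ i≢i → i≢i refl))
    ... | tri> _ _ j<i  = trans (b-sym _ _) (trans (proj₂ (proj₂ (forced j i j<i)))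
                            (sym (yes-≢ (λ i≡j → Fin.<⇒≢ j<i (sym i≡j)))))

module PerronBound (m : ℕ) where

  open Perron m using (ρ; v; 0≺v; eigen-u; eigen-w; v-uu≺ww; v-uw≺wu)
  open ≈-Solver

  private
    n = suc m

    split : Fin (n ℕ.+ n) → Fin n ⊎ Fin n
    split = Fin.splitAt n

  eigen-⊎ : ∀ s → sum-⊎ (λ t → ι (adj s t) · v t) ≈ ρ · v s
  eigen-⊎ (inj₁ i) = ≈-trans (+-cong (sum-0· (λ j → v (inj₁ j))) ≈-refl) (≈-trans (+-identityˡ _) (eigen-u i))
  eigen-⊎ (inj₂ i) = eigen-w i

  module _ (y : Fin n ⊎ Fin n → ℝ) where

    private
      open module R = Rayleigh
        (λ i j → ι (adj (split i) (split j)))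
        (λ i j → ≡⇒≈ (cong ι (adj-sym (split i) (split j))))
        (λ i j → 0≼ι (adj (split i) (split j)))
        (v ∘ split) (λ i → 0≺v (split i)) ρ
        (λ i → ≈-trans (sum-splitAt n (λ t → ι (adj (split i) t) · v t)) (eigen-⊎ (split i)))
        (y ∘ split) using (bound; tight)

      quadratic≈ = quadratic-⊎-splitAt n (adj {n}) y
      norm²≈ = norm²-⊎-splitAt n y

    perron-bound : quadratic-⊎ adj y ≼ ρ · norm²-⊎ y
    perron-bound = ≼-trans (≈⇒≽ quadratic≈) (≼-trans bound (≈⇒≼ (·-congˡ ρ norm²≈)))

    module _ (0≼y : ∀ s → 0# ≼ y s) (0≺y² : 0# ≺ norm²-⊎ y) (maximal : ρ · norm²-⊎ y ≼ quadratic-⊎ adj y) where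

      private
        -- The first w is adjacent to all other vertices, so every ratio y / v is compared with its
        -- own in one step.
        root : Fin n ⊎ Fin n
        root = inj₂ zero

      neighbours : ∀ s t → adj s t ≡ true → y s · v t ≈ y t · v s
      neighbours s t st = ≈-trans (≈-sym (≡⇒≈ (cong₂ (λ a b → y a · v b) (Fin.splitAt-join n n s) (Fin.splitAt-join n n t))))
        (≈-trans (tight (≼-trans (≈⇒≼ (·-congˡ ρ norm²≈)) (≼-trans maximal (≈⇒≽ quadratic≈)))
           (Fin.join n n s) (Fin.join n n t)
           (subst (λ b → 0# ≺ ι b)
             (trans (sym st) (cong₂ adj (sym (Fin.splitAt-join n n s)) (sym (Fin.splitAt-join n n t)))) 0≺1))
        (≡⇒≈ (cong₂ (λ a b → y b · v a) (Fin.splitAt-join n n s) (Fin.splitAt-join n n t))))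

      proportional : ∀ t → v root · y t ≈ y root · v t
      proportional (inj₁ j)       = ≈-trans (·-comm _ _) (≈-sym (neighbours root (inj₁ j) refl))
      proportional (inj₂ zero)    = ·-comm _ _
      proportional (inj₂ (suc j)) = ≈-trans (·-comm _ _) (≈-sym (neighbours root (inj₂ (suc j)) refl))

      0≺y-root : 0# ≺ y root
      0≺y-root y≼0 = 0≺y² (≈⇒≼ (≈-trans
          (sum-⊎-cong {g = λ s → 0# · 0#} λ s → ·-cong (y≈0 s) (y≈0 s))
          (≈-trans (+-cong (sum-0· {n} (λ _ → 0#)) (sum-0· {n} (λ _ → 0#))) (+-identityˡ 0#))))
        where
        y≈0 : ∀ t → y t ≈ 0#
        y≈0 t = ·-cancelˡ-≈ (0≺v root) (≈-trans (proportional t)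
          (≈-trans (x≈0⇒x·y≈0 (v t) (≼-antisym y≼0 (0≼y root))) (≈-sym (y≈0⇒x·y≈0 (v root) ≈-refl))))

      -- By proportionality, (y root)² v a v b equals (v root)² y a y b, so products of v and of y
      -- are ordered alike.
      transfer-≺ : ∀ {a b c d} → v a · v b ≺ v c · v d → y a · y b ≺ y c · y d
      transfer-≺ {a} {b} {c} {d} h k = ·-monoˡ-≺ (0≺x·y 0≺y-root 0≺y-root) h
        (≼-trans (≈⇒≼ (scaled c d)) (≼-trans
          (·-monoˡ-≼ (≺⇒≼ (0≺x·y (0≺v root) (0≺v root))) k) (≈⇒≽ (scaled a b))))
        where
        scaled : ∀ a b → (y root · y root) · (v a · v b) ≈ (v root · v root) · (y a · y b)
        scaled a b = ≈-trans (rearrange (y root) (v a) (v b))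
          (≈-trans (·-cong (≈-sym (proportional a)) (≈-sym (proportional b)))
            (≈-sym (rearrange (v root) (y a) (y b))))
          where
          rearrange : ∀ k x y → (k · k) · (x · y) ≈ (k · x) · (k · y)
          rearrange = solve 3 (λ k x y → (k :* k) :* (x :* y) := (k :* x) :* (k :* y)) ≈-refl

      y-uu≺ww : ∀ i j → i Fin.< j → y (inj₁ i) · y (inj₁ j) ≺ y (inj₂ i) · y (inj₂ j)
      y-uu≺ww i j i<j = transfer-≺ (v-uu≺ww i j i<j)

      y-uw≺wu : ∀ i j → i Fin.< j → y (inj₁ i) · y (inj₂ j) ≺ y (inj₂ i) · y (inj₁ j)
      y-uw≺wu i j i<j = transfer-≺ (v-uw≺wu i j i<j)

-- Matchings

-- Where w i vanishes, so does u i, and every ratio u i / w i is admissible; w i is replaced by 1 there.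
ratio-sort : ∀ {n} (u w : Fin n → ℝ) → (∀ i → 0# ≼ u i) → (∀ i → u i ≼ w i) →
  DoubleNegation (Σ (Permutation n n) λ π → ∀ i j → i Fin.≤ j →
    u (π ⟨$⟩ʳ i) · w (π ⟨$⟩ʳ j) ≼ w (π ⟨$⟩ʳ i) · u (π ⟨$⟩ʳ j))
ratio-sort {n} u w 0≼u u≼w h =
  -- Whether w i vanishes is settled for all `i` at once: finitely many double negations combine
  -- into one.
  Fin.sequence (RawMonad.rawApplicative ¬¬-Monad) denominator λ d →
  let P , 0≺P , p , dp = cofactors (λ i → proj₁ (d i)) (λ i → proj₁ (proj₂ (d i)))
  in sort (λ i → u i · p i) λ (π , sorted) → h (π , λ i j i≤j →
    compare (d (π ⟨$⟩ʳ i)) (d (π ⟨$⟩ʳ j)) 0≺P (dp (π ⟨$⟩ʳ i)) (dp (π ⟨$⟩ʳ j)) (sorted i j i≤j))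
  where
  open ≈-Solver
  Denominator : Fin n → Set
  Denominator i = ∃[ d ] 0# ≺ d × (w i ≈ 0# ⊎ d ≈ w i)
  denominator : ∀ i → DoubleNegation (Denominator i)
  denominator i k = ≼⊎≺ (w i) 0# (λ f → f id)
    (λ w≼0 → k (1# , 0≺1 , inj₁ (≼-antisym w≼0 (≼-trans (0≼u i) (u≼w i)))))
    (λ 0≺w → k (w i , 0≺w , inj₂ ≈-refl))
  0≼w : ∀ i → 0# ≼ w i
  0≼w i = ≼-trans (0≼u i) (u≼w i)
  compare : ∀ {i j P pᵢ pⱼ} (dᵢ : Denominator i) (dⱼ : Denominator j) → 0# ≺ P →
    proj₁ dᵢ · pᵢ ≈ P → proj₁ dⱼ · pⱼ ≈ P → u i · pᵢ ≼ u j · pⱼ → u i · w j ≼ w i · u j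
  compare {i} {j} (_ , _ , inj₁ w≈0) _ _ _ _ _ = ≼-trans
    (≈⇒≼ (x≈0⇒x·y≈0 (w j) (≼-antisym (≼-trans (u≼w i) (≈⇒≼ w≈0)) (0≼u i)))) (0≼x·y (0≼w i) (0≼u j))
  compare {i} {j} (_ , _ , inj₂ _) (_ , _ , inj₁ w≈0) _ _ _ _ = ≼-trans
    (≈⇒≼ (y≈0⇒x·y≈0 (u i) w≈0)) (0≼x·y (0≼w i) (0≼u j))
  compare {i} {j} {P} {pᵢ} {pⱼ} (dᵢ , 0≺dᵢ , inj₂ dᵢ≈w) (dⱼ , 0≺dⱼ , inj₂ dⱼ≈w) 0≺P dpᵢ dpⱼ k =
    ·-cancelˡ-≼ 0≺P (≼-trans (≈⇒≼ left) (≼-trans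
      (·-monoˡ-≼ (≺⇒≼ (0≺x·y 0≺dᵢ 0≺dⱼ)) k) (≈⇒≼ right)))
    where
    left : P · (u i · w j) ≈ (dᵢ · dⱼ) · (u i · pᵢ)
    left = ≈-trans (·-cong (≈-sym dpᵢ) (·-congˡ _ (≈-sym dⱼ≈w)))
      (solve 4 (λ d p u e → (d :* p) :* (u :* e) := (d :* e) :* (u :* p)) ≈-refl dᵢ pᵢ (u i) dⱼ)
    right : (dᵢ · dⱼ) · (u j · pⱼ) ≈ P · (w i · u j)
    right = ≈-trans
      (solve 4 (λ d p u e → (e :* d) :* (u :* p) := (d :* p) :* (e :* u)) ≈-refl dⱼ pⱼ (u j) dᵢ)
      (·-cong dpⱼ (·-congʳ _ dᵢ≈w))

lookup-injective : ∀ {A : Set} {xs : List A} → Unique xs → ∀ i j → lookup xs i ≡ lookup xs j → i ≡ j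
lookup-injective (_ ∷ _)    zero    zero    _  = refl
lookup-injective (x≢ ∷ _)   zero    (suc j) eq = contradiction eq (All.lookup x≢ (∈-lookup j))
lookup-injective (x≢ ∷ _)   (suc i) zero    eq = contradiction (sym eq) (All.lookup x≢ (∈-lookup i))
lookup-injective (_ ∷ uniq) (suc i) (suc j) eq = cong suc (lookup-injective uniq i j eq)

-- Each orbit is represented by its smaller element. The points will be vertices numbered by
-- increasing y, so the representative is the lighter end of its matching edge.
module Orbits {N : ℕ} (q : Fin N → Fin N) (involutive : ∀ a → q (q a) ≡ a) (fixpoint-free : ∀ a → q a ≢ a) where

  smaller : List (Fin N)
  smaller = filter (λ a → a Fin.<? q a) (allFin N)

  number : ℕ
  number = length smaller

  representative : Fin number → Fin N
  representative = lookup smaller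

  representative-< : ∀ i → representative i Fin.< q (representative i)
  representative-< i = proj₂ (∈-filter⁻ (λ a → a Fin.<? q a) {xs = allFin N} (∈-lookup i))

  member : Fin number ⊎ Fin number → Fin N
  member (inj₁ i) = representative i
  member (inj₂ i) = q (representative i)

  private
    q-injective : ∀ {a b} → q a ≡ q b → a ≡ b
    q-injective {a} {b} eq = trans (sym (involutive a)) (trans (cong q eq) (involutive b))

    representative-injective : ∀ {i j} → representative i ≡ representative j → i ≡ j
    representative-injective {i} {j} = lookup-injective
      (Unique.filter⁺ (λ a → a Fin.<? q a) (allFin⁺ N)) i j

    distinct : ∀ i j → representative i ≢ q (representative j)
    distinct i j eq = ℕ.<-asym (representative-< j)
      (subst₂ (λ a b → Fin.toℕ a ℕ.< Fin.toℕ b) eq (trans (cong q eq) (involutive _)) (representative-< i))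

    member-injective : ∀ {s t} → member s ≡ member t → s ≡ t
    member-injective {inj₁ i} {inj₁ j} eq = cong inj₁ (representative-injective eq)
    member-injective {inj₁ i} {inj₂ j} eq = contradiction eq (distinct i j)
    member-injective {inj₂ i} {inj₁ j} eq = contradiction (sym eq) (distinct j i)
    member-injective {inj₂ i} {inj₂ j} eq = cong inj₂ (representative-injective (q-injective eq))

    find : ∀ a → a Fin.< q a → ∃[ i ] representative i ≡ a
    find a a<qa = Any.index a∈ , sym (lookup-index a∈)
      where
      a∈ : a ∈ smaller
      a∈ = ∈-filter⁺ (λ a → a Fin.<? q a) (∈-allFin a) a<qa

    member-surjective : ∀ a → ∃[ s ] member s ≡ a
    member-surjective a with Fin.<-cmp a (q a)
    ... | tri< a<qa _ _ = let i , eq = find a a<qa in inj₁ i , eq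
    ... | tri≈ _ a≡qa _ = contradiction (sym a≡qa) (fixpoint-free a)
    ... | tri> _ _ qa<a =
      let i , eq = find (q a) (subst (q a Fin.<_) (sym (involutive a)) qa<a)
      in inj₂ i , trans (cong q eq) (involutive a)

  enumeration : (Fin number ⊎ Fin number) ↔ Fin N
  enumeration = ⤖⇒↔ (mk⤖ (member-injective , λ a → let s , eq = member-surjective a in
    s , λ { refl → eq }))

module UniqueMatching (G : Defs.Graph) (unique : Defs.HasUniquePerfectMatching G) where

  open Defs.Graph G
  open Defs.PerfectMatching (proj₁ unique)

  index : V → Fin order
  index = Inverse.from vertices

  vertex : Fin order → V
  vertex = Inverse.to vertices

  vertex-index : ∀ v → vertex (index v) ≡ v
  vertex-index = Inverse.strictlyInverseˡ vertices

  infix 4 _≟_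

  _≟_ : DecidableEquality V
  v ≟ w with index v Fin.≟ index w
  ... | yes eq = yes (trans (sym (vertex-index v)) (trans (cong vertex eq) (vertex-index w)))
  ... | no neq = no (neq ∘ cong index)

  partner : V → V
  partner v = proj₁ (perfect v)

  matched : ∀ v → Matched v (partner v)
  matched v = proj₁ (proj₂ (perfect v))

  partner-unique : ∀ {v w} → Matched v w → partner v ≡ w
  partner-unique {v} = proj₂ (proj₂ (perfect v))

  partner-involutive : ∀ v → partner (partner v) ≡ v
  partner-involutive v = partner-unique (symm (matched v))

  ~-partner : ∀ v → v ~ partner v
  ~-partner v = edges (matched v)

  ≢-irrefl : ∀ {v w} → v ~ w → v ≢ w
  ≢-irrefl v~w v≡w = ~-irrefl v≡w v~w

  -- An alternating 4-cycle v, w, partner w, partner v would give a second perfect matching.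
  module AlternatingCycle (v w : V) (v~w : v ~ w) (pv~pw : partner v ~ partner w) (w≢pv : w ≢ partner v) where

    private
      p = partner

      pp≡ : ∀ {x y} → p x ≡ y → p y ≡ x
      pp≡ {x} refl = partner-involutive x

      v≢w  = ≢-irrefl v~w
      v≢pv = ≢-irrefl (~-partner v)
      w≢pw = ≢-irrefl (~-partner w)
      pv≢pw = ≢-irrefl pv~pw

      v≢pw : v ≢ p w
      v≢pw eq = w≢pv (sym (pp≡ (sym eq)))

    data View (z : V) : Set where
      is-v  : z ≡ v → View z
      is-w  : z ≡ w → View z
      is-pv : z ≡ p v → View z
      is-pw : z ≡ p w → View z
      other : z ≢ v → z ≢ w → z ≢ p v → z ≢ p w → View z

    view : ∀ z → View z
    view z with z ≟ v | z ≟ w | z ≟ p v | z ≟ p w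
    ... | yes eq | _      | _      | _      = is-v eq
    ... | no _   | yes eq | _      | _      = is-w eq
    ... | no _   | no _   | yes eq | _      = is-pv eq
    ... | no _   | no _   | no _   | yes eq = is-pw eq
    ... | no a   | no b   | no c   | no d   = other a b c d

    switch′ : ∀ {z} → View z → V
    switch′ (is-v _)          = w
    switch′ (is-w _)          = v
    switch′ (is-pv _)         = p w
    switch′ (is-pw _)         = p v
    switch′ {z} (other _ _ _ _) = p z

    switch : V → V
    switch z = switch′ (view z)

    -- The vertices v, w, p v, p w are distinct, so all views of a vertex agree. This lets `switch`
    -- be evaluated at a known vertex by supplying its view.
    switch′-irrelevant : ∀ {z} (a b : View z) → switch′ a ≡ switch′ b
    switch′-irrelevant (is-v _) (is-v _) = refl
    switch′-irrelevant (is-v refl) (is-w eq) = contradiction eq v≢w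
    switch′-irrelevant (is-v refl) (is-pv eq) = contradiction eq v≢pv
    switch′-irrelevant (is-v refl) (is-pw eq) = contradiction eq v≢pw
    switch′-irrelevant (is-v refl) (other a _ _ _) = contradiction refl a
    switch′-irrelevant (is-w refl) (is-v eq) = contradiction (sym eq) v≢w
    switch′-irrelevant (is-w _) (is-w _) = refl
    switch′-irrelevant (is-w refl) (is-pv eq) = contradiction eq w≢pv
    switch′-irrelevant (is-w refl) (is-pw eq) = contradiction eq w≢pw
    switch′-irrelevant (is-w refl) (other _ b _ _) = contradiction refl b
    switch′-irrelevant (is-pv refl) (is-v eq) = contradiction (sym eq) v≢pv
    switch′-irrelevant (is-pv refl) (is-w eq) = contradiction (sym eq) w≢pv
    switch′-irrelevant (is-pv _) (is-pv _) = refl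
    switch′-irrelevant (is-pv refl) (is-pw eq) = contradiction eq pv≢pw
    switch′-irrelevant (is-pv refl) (other _ _ c _) = contradiction refl c
    switch′-irrelevant (is-pw refl) (is-v eq) = contradiction (sym eq) v≢pw
    switch′-irrelevant (is-pw refl) (is-w eq) = contradiction (sym eq) w≢pw
    switch′-irrelevant (is-pw refl) (is-pv eq) = contradiction (sym eq) pv≢pw
    switch′-irrelevant (is-pw _) (is-pw _) = refl
    switch′-irrelevant (is-pw refl) (other _ _ _ d) = contradiction refl d
    switch′-irrelevant (other a _ _ _) (is-v refl) = contradiction refl a
    switch′-irrelevant (other _ b _ _) (is-w refl) = contradiction refl b
    switch′-irrelevant (other _ _ c _) (is-pv refl) = contradiction refl c
    switch′-irrelevant (other _ _ _ d) (is-pw refl) = contradiction refl d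
    switch′-irrelevant (other _ _ _ _) (other _ _ _ _) = refl

    switch-view : ∀ {z} (a : View z) → switch z ≡ switch′ a
    switch-view {z} a = switch′-irrelevant (view z) a

    switch-involutive : ∀ z → switch (switch z) ≡ z
    switch-involutive z with view z
    ... | is-v refl  = switch-view (is-w refl)
    ... | is-w refl  = switch-view (is-v refl)
    ... | is-pv refl = switch-view (is-pw refl)
    ... | is-pw refl = switch-view (is-pv refl)
    ... | other a b c d = trans
      (switch-view (other (λ eq → c (sym (pp≡ eq))) (λ eq → d (sym (pp≡ eq)))
        (λ eq → a (trans (sym (pp≡ refl)) (pp≡ (sym eq)))) (λ eq → b (trans (sym (pp≡ refl)) (pp≡ (sym eq))))))
      (partner-involutive z)

    ~-switch : ∀ z → z ~ switch z
    ~-switch z with view z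
    ... | is-v refl  = v~w
    ... | is-w refl  = ~-sym v~w
    ... | is-pv refl = pv~pw
    ... | is-pw refl = ~-sym pv~pw
    ... | other _ _ _ _ = ~-partner z

    switched : Defs.PerfectMatching G
    switched = record
      { Matched = λ a b → switch a ≡ b
      ; symm    = λ { {a} refl → switch-involutive a }
      ; edges   = λ { {a} refl → ~-switch a }
      ; perfect = λ a → switch a , refl , id }

    -- The switched matching joins v to w, whereas uniqueness would join it to p v.
    impossible : ⊥
    impossible = w≢pv (trans (sym (switch-view (is-v refl)))
      (Equivalence.to (proj₂ unique switched v (p v)) (matched v)))

  no-alternating-cycle : ∀ v w → w ≢ partner v → v ~ w → ¬ (partner v ~ partner w)
  no-alternating-cycle v w w≢pv v~w pv~pw = AlternatingCycle.impossible v w v~w pv~pw w≢pv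

-- Graphs and eigenvalues

sum-reindex : ∀ {A : Set} {m n} (e : Fin m ↔ A) (e′ : Fin n ↔ A) (f : A → ℝ) →
  sum (f ∘ Inverse.to e) ≈ sum (f ∘ Inverse.to e′)
sum-reindex e e′ f = ≈-trans (sum-permute (f ∘ Inverse.to e) (↔-trans e′ (↔-sym e)))
  (sum-cong λ i → ≡⇒≈ (cong f (Inverse.strictlyInverseˡ e (Inverse.to e′ i))))

sum-reindex-⊎ : ∀ {A : Set} {m n k} (e : Fin m ↔ A) (φ : (Fin n ⊎ Fin k) ↔ A) (f : A → ℝ) →
  sum (f ∘ Inverse.to e) ≈ sum-⊎ (f ∘ Inverse.to φ)
sum-reindex-⊎ {n = n} e φ f = ≈-trans (sum-reindex e (↔-trans Fin.+↔⊎ φ) f) (sum-splitAt n (f ∘ Inverse.to φ))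

opaque
  unfolding ⌜_⌝ sum

  Defs-sum : ∀ {n} (f : Fin n → ℝ) y → sum f ≈ y → Defs.sum f ≈ y
  Defs-sum f y h = h

  Defs-sum⁻¹ : ∀ {n} (f : Fin n → ℝ) y → Defs.sum f ≈ y → sum f ≈ y
  Defs-sum⁻¹ f y h = h

  Defs-* : ∀ x y z → x · y ≈ z → x Defs.* y ≈ z
  Defs-* x y z h = h

  ≈-Defs-* : ∀ x y z → z ≈ x · y → z ≈ x Defs.* y
  ≈-Defs-* x y z h = h

  ≈-Defs-*⁻¹ : ∀ x y z → z ≈ x Defs.* y → z ≈ x · y
  ≈-Defs-*⁻¹ x y z h = h

  Defs-0 : Defs.0ℝ ≡ 0#
  Defs-0 = refl

  Defs-1 : Defs.1ℝ ≡ 1#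
  Defs-1 = refl

module _ (G : Graph) where

  open Graph G

  private
    at : Fin order → V
    at = Inverse.to vertices

  private
    sumV⇒sum : ∀ (f g : V → ℝ) y → (∀ w → f w ≈ g w) → sumV f ≈ y → sum (g ∘ at) ≈ y
    sumV⇒sum f g y f≈g h = ≈-trans (≈-sym (sum-cong (f≈g ∘ at))) (Defs-sum⁻¹ (f ∘ at) y h)

    sum⇒sumV : ∀ (f g : V → ℝ) y → (∀ w → f w ≈ g w) → sum (g ∘ at) ≈ y → sumV f ≈ y
    sum⇒sumV f g y f≈g h = Defs-sum (f ∘ at) y (≈-trans (sum-cong (f≈g ∘ at)) h)

  -- Stated for an arbitrary matrix α: with the adjacency matrix in its place, the conversion
  -- checker would unfold proofs of convergence.
  module _ (r : ℝ) (x : V → ℝ) (α β : V → V → ℝ) (α≡β : ∀ v w → α v w ≡ β v w) where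

    private
      term≈ : ∀ v w → α v w Defs.* x w ≈ β v w · x w
      term≈ v w = Defs-* (α v w) (x w) (β v w · x w) (·-congʳ (x w) (≡⇒≈ (α≡β v w)))

    from-≃ : (∀ v → sumV (λ w → α v w Defs.* x w) ≃ r Defs.* x v) →
      ∀ v → sum (λ a → β v (at a) · x (at a)) ≈ r · x v
    from-≃ eq v = sumV⇒sum (λ w → α v w Defs.* x w) (λ w → β v w · x w) (r · x v) (term≈ v)
      (≈-Defs-*⁻¹ r (x v) (sumV (λ w → α v w Defs.* x w)) (≃⇒≈ (eq v)))

    to-≃ : (∀ v → sum (λ a → β v (at a) · x (at a)) ≈ r · x v) →
      ∀ v → sumV (λ w → α v w Defs.* x w) ≃ r Defs.* x v
    to-≃ eq v = ≈⇒≃ (≈-Defs-* r (x v) (sumV (λ w → α v w Defs.* x w))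
      (sum⇒sumV (λ w → α v w Defs.* x w) (λ w → β v w · x w) (r · x v) (term≈ v) (eq v)))

  EigenEquation : ℝ → (V → ℝ) → Set
  EigenEquation r x = ∀ v → sum (λ a → ι (does (v ~? at a)) · x (at a)) ≈ r · x v

  adjacency≡ι : ∀ v w → adjacency v w ≡ ι (does (v ~? w))
  adjacency≡ι v w with does (v ~? w)
  ... | true  = Defs-1
  ... | false = Defs-0

  eigenvector : ∀ r → IsEigenvalue G r → Σ (V → ℝ) λ x → ¬ (∀ v → x v ≈ 0#) × EigenEquation r x
  eigenvector r (x , x≄0 , eq) = x
    , (λ x≈0 → x≄0 λ v → ≈⇒≃ (subst (x v ≈_) (sym Defs-0) (x≈0 v)))
    , from-≃ r x adjacency (λ v w → ι (does (v ~? w))) adjacency≡ι eq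

  isEigenvalue : ∀ r (x : V → ℝ) → ¬ (∀ v → x v ≈ 0#) → EigenEquation r x → IsEigenvalue G r
  isEigenvalue r x x≉0 eq = x
    , (λ x≃0 → x≉0 λ v → subst (x v ≈_) Defs-0 (≃⇒≈ (x≃0 v)))
    , to-≃ r x adjacency (λ v w → ι (does (v ~? w))) adjacency≡ι eq

≅-eigenvalue : ∀ {G H} → G ≅ H → ∀ r → IsEigenvalue H r → IsEigenvalue G r
≅-eigenvalue {G} {H} iso r ev = isEigenvalue G r (ξ ∘ to) (λ ξ≈0 → ξ≉0 λ w →
    subst (λ w → ξ w ≈ 0#) (Inverse.strictlyInverseˡ bijection w) (ξ≈0 (Inverse.from bijection w)))
  λ v → ≈-trans (sum-cong λ a → ·-congʳ _ (≡⇒≈ (cong ι (does-⇔ (preserves v _) (v G.~? _) (to v H.~? _)))))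
    (≈-trans (sum-reindex (↔-trans G.vertices bijection) H.vertices (λ w → ι (does (to v H.~? w)) · ξ w)) (eq (to v)))
  where
  open _≅_ iso
  module G = Graph G
  module H = Graph H
  to = Inverse.to bijection
  ξ = proj₁ (eigenvector H r ev)
  ξ≉0 = proj₁ (proj₂ (eigenvector H r ev))
  eq = proj₂ (proj₂ (eigenvector H r ev))

-- Decidability of graph isomorphism

vec-any? : ∀ {N} k {P : Vec (Fin N) k → Set} → (∀ v → Dec (P v)) → Dec (∃ P)
vec-any? zero    P? = map′ ([] ,_) (λ { ([] , p) → p }) (P? [])
vec-any? (suc k) P? = map′ (λ (a , v , p) → a ∷ v , p) (λ { (a ∷ v , p) → a , v , p })
  (Fin.any? λ a → vec-any? k λ v → P? (a ∷ v))

-- A finite search over pairs of vectors that code mutually inverse maps of vertex numbers; unlike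
-- functions, vectors can be enumerated entry by entry.
_≅?_ : ∀ G H → Dec (G ≅ H)
G ≅? H = map′ (λ (f , g , p) → decode f g p) encode
    (vec-any? G.order λ f → vec-any? H.order λ g →
      Fin.all? (λ a → Vec.lookup g (Vec.lookup f a) Fin.≟ a) ×-dec
      Fin.all? (λ b → Vec.lookup f (Vec.lookup g b) Fin.≟ b) ×-dec
      Fin.all? (λ a → Fin.all? λ b →
        ((e a G.~? e b) →-dec (d (Vec.lookup f a) H.~? d (Vec.lookup f b))) ×-dec
        ((d (Vec.lookup f a) H.~? d (Vec.lookup f b)) →-dec (e a G.~? e b))))
  where
  module G = Graph G
  module H = Graph H
  e = Inverse.to G.vertices
  e⁻¹ = Inverse.from G.vertices
  d = Inverse.to H.vertices
  d⁻¹ = Inverse.from H.vertices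
  Iso : Vec (Fin H.order) G.order → Vec (Fin G.order) H.order → Set
  Iso f g = (∀ a → Vec.lookup g (Vec.lookup f a) ≡ a) × (∀ b → Vec.lookup f (Vec.lookup g b) ≡ b) ×
    (∀ a b → (e a G.~ e b → d (Vec.lookup f a) H.~ d (Vec.lookup f b)) ×
             (d (Vec.lookup f a) H.~ d (Vec.lookup f b) → e a G.~ e b))
  decode : ∀ f g → Iso f g → G ≅ H
  decode f g (gf , fg , adj⇔) = record
    { bijection = ↔-trans (↔-sym G.vertices)
        (↔-trans (mk↔ₛ′ (Vec.lookup f) (Vec.lookup g) fg gf) H.vertices)
    ; preserves = λ u v → let to , from = adj⇔ (e⁻¹ u) (e⁻¹ v) in mk⇔
        (λ u~v → to (subst₂ G._~_ (sym (e∘e⁻¹ u)) (sym (e∘e⁻¹ v)) u~v))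
        (λ fu~fv → subst₂ G._~_ (e∘e⁻¹ u) (e∘e⁻¹ v) (from fu~fv)) }
    where
    e∘e⁻¹ = Inverse.strictlyInverseˡ G.vertices
  encode : G ≅ H → ∃ λ f → ∃ λ g → Iso f g
  encode iso = Vec.tabulate f , Vec.tabulate g
    , (λ a → trans (lookup∘tabulate g _) (trans (cong g (lookup∘tabulate f a)) (Inverse.strictlyInverseʳ π a)))
    , (λ b → trans (lookup∘tabulate f _) (trans (cong f (lookup∘tabulate g b)) (Inverse.strictlyInverseˡ π b)))
    , λ a b → (λ h → subst₂ H._~_ (image a) (image b) (Equivalence.to (preserves (e a) (e b)) h))
            , (λ h → Equivalence.from (preserves (e a) (e b)) (subst₂ H._~_ (sym (image a)) (sym (image b)) h))
    where
    open _≅_ iso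
    π : Fin G.order ↔ Fin H.order
    π = ↔-trans G.vertices (↔-trans bijection (↔-sym H.vertices))
    f = Inverse.to π
    g = Inverse.from π
    image : ∀ a → Inverse.to bijection (e a) ≡ d (Vec.lookup (Vec.tabulate f) a)
    image a = sym (trans (cong d (lookup∘tabulate f a)) (Inverse.strictlyInverseˡ H.vertices _))

-- Comparison of G with G(2n,1)

module Arrangements (G : Graph) (unique : HasUniquePerfectMatching G) where

  open Graph G
  open UniqueMatching G unique

  -- `sorted` compares the ratios y u / y w in cross-multiplied form, which stays meaningful where y
  -- vanishes.
  record Arrangement (n : ℕ) (y : V → ℝ) : Set where
    field
      φ : (Fin n ⊎ Fin n) ↔ V

    u : Fin n → V
    u = λ i → Inverse.to φ (inj₁ i)

    w : Fin n → V
    w = λ i → Inverse.to φ (inj₂ i)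

    field
      paired   : ∀ i → partner (u i) ≡ w i
      oriented : ∀ i → y (u i) ≼ y (w i)
      sorted   : ∀ i j → i Fin.≤ j → y (u i) · y (w j) ≼ y (w i) · y (u j)

  -- Sorting the vertices by y orients every matching edge by vertex number. The sort by ratio then
  -- applies one permutation to both ends, which keeps pairs and orientation.
  arrangement : (y : V → ℝ) → (∀ v → 0# ≼ y v) → DoubleNegation (∃[ n ] Arrangement n y)
  arrangement y 0≼y h = sort (y ∘ vertex) λ (π , y-mono) → arrange π y-mono
    where
    arrange : (π : Permutation order order) →
      (∀ i j → i Fin.≤ j → y (vertex (π ⟨$⟩ʳ i)) ≼ y (vertex (π ⟨$⟩ʳ j))) → _
    arrange π y-mono = ratio-sort (y ∘ u) (y ∘ w) (λ i → 0≼y _) y-oriented λ (τ , y-sorted) →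
      h (number , record
        { φ = ↔-trans (τ ⊎-↔ τ) φ
        ; paired = λ i → partner-w (τ ⟨$⟩ʳ i)
        ; oriented = λ i → y-oriented (τ ⟨$⟩ʳ i)
        ; sorted = y-sorted })
      where
      e : Fin order ↔ V
      e = ↔-trans π vertices
      to = Inverse.to e
      from = Inverse.from e
      from-to = Inverse.strictlyInverseʳ e
      to-from = Inverse.strictlyInverseˡ e
      open Orbits (from ∘ partner ∘ to)
        (λ a → trans (cong (from ∘ partner) (to-from _))
          (trans (cong from (partner-involutive (to a))) (from-to a)))
        (λ a eq → ≢-irrefl (~-partner (to a)) (trans (cong to (sym eq)) (to-from _)))
      φ : (Fin number ⊎ Fin number) ↔ V
      φ = ↔-trans enumeration e
      u w : Fin number → V
      u i = Inverse.to φ (inj₁ i)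
      w i = Inverse.to φ (inj₂ i)
      partner-w : ∀ i → partner (u i) ≡ w i
      partner-w i = sym (to-from _)
      y-oriented : ∀ i → y (u i) ≼ y (w i)
      y-oriented i = y-mono _ _ (ℕ.<⇒≤ (representative-< i))

  arrangement-size : ∀ {n y} → Arrangement n y → n ℕ.+ n ≡ order
  arrangement-size A = Perm.↔⇒≡ (↔-trans Fin.+↔⊎ (↔-trans φ (↔-sym vertices)))
    where open Arrangement A

  module Spectral (m : ℕ) (r : ℝ) (x : V → ℝ) (x≉0 : ¬ (∀ v → x v ≈ 0#)) (eq : EigenEquation G r x)
    (A : Arrangement (suc m) (λ v → ∣ x v ∣ℝ)) where

    open Arrangement A
    open ≈-Solver
    open Perron m using (ρ)

    private
      S = Fin (suc m) ⊎ Fin (suc m)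

      to : S → V
      to = Inverse.to φ

      to-injective : ∀ {s t} → to s ≡ to t → s ≡ t
      to-injective {s} {t} h = trans (sym (Inverse.strictlyInverseʳ φ s))
        (trans (cong (Inverse.from φ) h) (Inverse.strictlyInverseʳ φ t))

      true⇒~ : ∀ v v′ → does (v ~? v′) ≡ true → v ~ v′
      true⇒~ v v′ h with v ~? v′
      ... | yes v~v′ = v~v′

    b : S → S → Bool
    b s t = does (to s ~? to t)

    η : S → ℝ
    η s = ∣ x (to s) ∣ℝ

    0≼y : ∀ s → 0# ≼ η s
    0≼y s = 0≼∣x∣ (x (to s))

    b-sym : ∀ s t → b s t ≡ b t s
    b-sym s t = does-⇔ (mk⇔ ~-sym ~-sym) (to s ~? to t) (to t ~? to s)

    b-irrefl : ∀ s → b s s ≡ false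
    b-irrefl s with to s ~? to s
    ... | yes loop = contradiction refl (≢-irrefl loop)
    ... | no _     = refl

    b-matched : ∀ i → b (inj₁ i) (inj₂ i) ≡ true
    b-matched i = dec-true (u i ~? w i) (subst (u i ~_) (paired i) (~-partner (u i)))

    -- The cycle u i, u j, w j, w i would alternate with the matching; in `crossing` it is u i, w j,
    -- u j, w i.
    parallel : ∀ i j → i ≢ j → ¬ (b (inj₁ i) (inj₁ j) ≡ true × b (inj₂ i) (inj₂ j) ≡ true)
    parallel i j i≢j (uu , ww) = no-alternating-cycle (u i) (u j)
      (λ eq → case to-injective {inj₁ j} {inj₂ i} (trans eq (paired i)) of λ ())
      (true⇒~ _ _ uu)
      (subst₂ _~_ (sym (paired i)) (sym (paired j)) (true⇒~ _ _ ww))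

    crossing : ∀ i j → i ≢ j → ¬ (b (inj₁ i) (inj₂ j) ≡ true × b (inj₂ i) (inj₁ j) ≡ true)
    crossing i j i≢j (uw , wu) = no-alternating-cycle (u i) (w j)
      (λ eq → case to-injective {inj₂ j} {inj₂ i} (trans eq (paired i)) of λ { refl → i≢j refl })
      (true⇒~ _ _ uw)
      (subst₂ _~_ (sym (paired i))
        (sym (trans (cong partner (sym (paired j))) (partner-involutive (u j)))) (true⇒~ _ _ wu))

    open Comparison b b-sym b-irrefl b-matched parallel crossing η 0≼y oriented sorted

    eigen : ∀ s → sum-⊎ (λ t → ι (b s t) · x (to t)) ≈ r · x (to s)
    eigen s = ≈-trans (≈-sym (sum-reindex-⊎ vertices φ (λ v → ι (does (to s ~? v)) · x v))) (eq (to s))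

    norm²-y : norm²-⊎ η ≈ norm²-⊎ (x ∘ to)
    norm²-y = sum-⊎-cong λ s → ∣x∣·∣x∣≈x·x (x (to s))

    rayleigh-x : r · norm²-⊎ (x ∘ to) ≈ quadratic-⊎ b (x ∘ to)
    rayleigh-x = ≈-trans (·-sum-⊎ r (λ s → x (to s) · x (to s))) (sum-⊎-cong λ s → ≈-trans
      (solve 2 (λ r x → r :* (x :* x) := x :* (r :* x)) ≈-refl r (x (to s)))
      (≈-trans (·-congˡ (x (to s)) (≈-sym (eigen s)))
      (≈-trans (·-sum-⊎ (x (to s)) (λ t → ι (b s t) · x (to t))) (sum-⊎-cong λ t →
        solve 3 (λ x b z → x :* (b :* z) := b :* (x :* z)) ≈-refl (x (to s)) (ι (b s t)) (x (to t))))))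

    -- Adjacency entries are nonnegative, so absolute values cannot decrease the form, while they
    -- preserve the norm.
    rayleigh-y : r · norm²-⊎ η ≼ quadratic-⊎ b η
    rayleigh-y = ≼-trans (≈⇒≼ (≈-trans (·-congˡ r norm²-y) rayleigh-x))
      (sum-⊎-mono λ s → sum-⊎-mono λ t → ·-monoˡ-≼ (0≼ι (b s t)) (x·y≼∣x∣·∣y∣ (x (to s)) (x (to t))))

    0≺norm² : 0# ≺ norm²-⊎ η
    0≺norm² y²≼0 = x≉0 λ v → subst (λ v → x v ≈ 0#) (Inverse.strictlyInverseˡ φ v) (x≈0 (Inverse.from φ v))
      where
      0≼squares : ∀ (g : Fin (suc m) → S) → 0# ≼ sum (λ i → η (g i) · η (g i))
      0≼squares g = 0≼sum λ i → 0≼x² (η (g i))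
      x≈0 : ∀ s → x (to s) ≈ 0#
      x≈0 s = x²≼0⇒x≈0 (≼-trans (≈⇒≽ (∣x∣·∣x∣≈x·x (x (to s)))) (y²s≼0 s))
        where
        y²s≼0 : ∀ s → η s · η s ≼ 0#
        y²s≼0 (inj₁ i) = 0≼sum-tight (λ i → 0≼x² (η (inj₁ i))) (≼-trans (≼-by _ (0≼squares inj₂) ≈-refl) y²≼0) i
        y²s≼0 (inj₂ i) = 0≼sum-tight (λ i → 0≼x² (η (inj₂ i)))
          (≼-trans (≼-by _ (0≼squares inj₁) (+-comm _ _)) y²≼0) i

    chain : r · norm²-⊎ η ≼ ρ · norm²-⊎ η
    chain = ≼-trans rayleigh-y (≼-trans quadratic-≼ (PerronBound.perron-bound m η))

    r≼ρ : r ≼ ρ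
    r≼ρ = ·-cancelˡ-≼ 0≺norm² (≼-trans (≈⇒≼ (·-comm _ _)) (≼-trans chain (≈⇒≼ (·-comm _ _))))

    module Extremal (ρ≼r : ρ ≼ r) where

      ρy²≼ry² : ρ · norm²-⊎ η ≼ r · norm²-⊎ η
      ρy²≼ry² = ·-monoʳ-≼ (≺⇒≼ 0≺norm²) ρ≼r

      -- The collapsed chain is used twice: here to make y extremal for G(2n,1), hence proportional
      -- to v, and then to equate the two quadratic forms.
      maximal : ρ · norm²-⊎ η ≼ quadratic-⊎ adj η
      maximal = ≼-trans ρy²≼ry² (≼-trans rayleigh-y quadratic-≼)

      open Tight (PerronBound.y-uu≺ww m η 0≼y 0≺norm² maximal) (PerronBound.y-uw≺wu m η 0≼y 0≺norm² maximal)
        (≼-trans (PerronBound.perron-bound m η) (≼-trans ρy²≼ry² rayleigh-y))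

      isomorphic : G ≅ G[2 suc m ,1]
      isomorphic = record
        { bijection = ↔-sym φ
        ; preserves = λ v v′ → mk⇔
            (λ v~v′ → true⇒Adj _ _ (trans (sym (b≡adj (from v) (from v′)))
              (dec-true (to (from v) ~? to (from v′)) (subst₂ _~_ (sym (to-from v)) (sym (to-from v′)) v~v′))))
            (λ adj-v-v′ → subst₂ _~_ (to-from v) (to-from v′) (true⇒~ _ _
              (trans (b≡adj (from v) (from v′)) (dec-true (Adj? (suc m) (from v) (from v′)) adj-v-v′)))) }
        where
        from = Inverse.from φ
        to-from = Inverse.strictlyInverseˡ φ
        true⇒Adj : ∀ s t → adj s t ≡ true → Adj (suc m) s t
        true⇒Adj s t h with Adj? (suc m) s t
        ... | yes st = st

ρ-eigenvalue : ∀ m → IsEigenvalue G[2 suc m ,1] (Perron.ρ m)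
ρ-eigenvalue m = isEigenvalue G[2 suc m ,1] ρ v (λ v≈0 → 0≺v (inj₁ zero) (≈⇒≼ (v≈0 (inj₁ zero)))) λ s →
    ≈-trans (sum-splitAt (suc m) (λ t → ι (adj s t) · v t)) (PerronBound.eigen-⊎ m s)
  where open Perron m

theorem1p1 : ∀ (n : ℕ) → n ≥ 1 →
    ∀ (G : Graph) → Graph.order G ≡ 2 * n → Connected G → HasUniquePerfectMatching G →
    ∀ (ρG ρ* : ℝ) → IsSpectralRadius G ρG → IsSpectralRadius G[2 n ,1] ρ* →
    (ρG ≤ ρ*) × ((ρG ≃ ρ*) ⇔ (G ≅ G[2 n ,1]))
theorem1p1 (suc m) _ G order≡2n _ unique ρG ρ* (ρG-eigenvalue , ρG-largest) (ρ*-eigenvalue , ρ*-largest) =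
  ≼⇒≤ ρG≼ρ* , mk⇔ equality⇒≅ ≅⇒equality
  where
  open Arrangements G unique
  open Perron m using (ρ)

  ξ = proj₁ (eigenvector G ρG ρG-eigenvalue)
  ξ≉0 = proj₁ (proj₂ (eigenvector G ρG ρG-eigenvalue))
  ξ-equation = proj₂ (proj₂ (eigenvector G ρG ρG-eigenvalue))

  η : Graph.V G → ℝ
  η v = ∣ ξ v ∣ℝ

  module Arranged = Spectral m ρG ξ ξ≉0 ξ-equation

  size : ∀ {k} → Arrangement k η → k ≡ suc m
  size {k} A = ℕ.*-cancelˡ-≡ k (suc m) 2
    (trans (cong (k ℕ.+_) (ℕ.+-identityʳ k)) (trans (arrangement-size A) order≡2n))

  arranged : {C : Set} → Stable C → (Arrangement (suc m) η → C) → C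
  arranged stable f = stable λ ¬c → arrangement η (λ v → 0≼∣x∣ (ξ v)) λ (k , A) →
    ¬c (f (subst (λ k → Arrangement k η) (size A) A))

  ρ≼ρ* : ρ ≼ ρ*
  ρ≼ρ* = ≤⇒≼ (ρ*-largest ρ (ρ-eigenvalue m))

  ρG≼ρ* : ρG ≼ ρ*
  ρG≼ρ* = ≼-trans (arranged ≼-stable Arranged.r≼ρ) ρ≼ρ*

  equality⇒≅ : ρG ≃ ρ* → G ≅ G[2 suc m ,1]
  equality⇒≅ ρG≃ρ* = arranged (decidable-stable (G ≅? G[2 suc m ,1])) λ A →
    Arranged.Extremal.isomorphic A (≼-trans ρ≼ρ* (≈⇒≽ (≃⇒≈ ρG≃ρ*)))

  ≅⇒equality : G ≅ G[2 suc m ,1] → ρG ≃ ρ*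
  ≅⇒equality iso = ≈⇒≃ (≼-antisym ρG≼ρ* (≤⇒≼ (ρG-largest ρ* (≅-eigenvalue iso ρ* ρ*-eigenvalue))))
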